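{- Let $r\geq 1$ be an integer and put $t=27720r+169$. Then for every integer $n$ with $$n\geq \frac{6911}{16}t^{2}+\frac{514441}{8}t-\frac{3309665}{16},$$ we have $f(n)\geq n+32t-1$. Equivalently, there exists a graph on $n$ vertices with $n+32t-1$ edges in which no two cycles have the same length.
   Context: For a positive integer $n$, $f(n)$ denotes the maximum number of edges in a (finite, simple) graph on $n$ vertices in which no two cycles have the same length (i.e., all cycles of the graph have pairwise distinct lengths). -}

module Defs where

open import Data.Nat using (ℕ; suc; _+_; _*_; _≤_; _<ᵇ_; _<?_)
open import Data.Nat.ListAction using (sum)
open import Data.Fin using (Fin; toℕ; fromℕ<; zero)
open import Data.Bool using (Bool; true; false; _∧_; if_then_else_)
open import Data.List using (List; map; allFin)
open import Data.Product using (Σ; ∃; _×_; _,_)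
open import Data.Sum using (_⊎_)
open import Relation.Nullary using (yes; no)
open import Relation.Binary.PropositionalEquality using (_≡_)
open import Function.Definitions using (Injective)

record Graph (n : ℕ) : Set where
  field
    adj    : Fin n → Fin n → Bool
    sym    : ∀ i j → adj i j ≡ adj j i
    irrefl : ∀ i → adj i i ≡ false
open Graph public

numEdges : ∀ {n} → Graph n → ℕ
numEdges {n} G =
  sum (map (λ i → sum (map (λ j → if adj G i j ∧ (toℕ i <ᵇ toℕ j) then 1 else 0)
                            (allFin n)))
           (allFin n))

cnext : ∀ {m} → Fin (suc m) → Fin (suc m)
cnext {m} i with suc (toℕ i) <? suc m
... | yes p = fromℕ< p
... | no _  = zero

record Cycle {n : ℕ} (G : Graph n) : Set where
  field
    m      : ℕ
    m≥2    : 2 ≤ m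
    vert   : Fin (suc m) → Fin n
    inj    : Injective _≡_ _≡_ vert
    isAdj  : ∀ i → adj G (vert i) (vert (cnext i)) ≡ true
open Cycle public

len : ∀ {n} {G : Graph n} → Cycle G → ℕ
len C = suc (m C)

CycleEdge : ∀ {n} {G : Graph n} → Cycle G → Fin n → Fin n → Set
CycleEdge C u v = ∃ λ i →
  (vert C i ≡ u × vert C (cnext i) ≡ v) ⊎ (vert C i ≡ v × vert C (cnext i) ≡ u)

-- Two cycle parametrisations describe the same cycle (subgraph) iff they
-- have the same edge set.
SameCycle : ∀ {n} {G : Graph n} → Cycle G → Cycle G → Set
SameCycle C D = ∀ u v → (CycleEdge C u v → CycleEdge D u v) × (CycleEdge D u v → CycleEdge C u v)

DistinctCycleLengths : ∀ {n} → Graph n → Set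
DistinctCycleLengths G = ∀ (C D : Cycle G) → len C ≡ len D → SameCycle C D

{-# OPTIONS --safe #-}

-- All blocks of the graph share one vertex, the hub, and removing the hub leaves a forest.  Hence a
-- cycle passes through the hub; apart from it, the cycle climbs from one neighbour of the hub to a
-- common ancestor in the forest and descends to another neighbour, so it is determined by these two
-- neighbours.  A block is either a cycle or a fan: a rim through the hub with spokes (paths) back to
-- the hub.  The separate cycles and the faces between neighbouring spokes have the lengths 3, 4, …,
-- 32t + 2, each once; all other cycles of the fans are longer and have pairwise distinct lengths.
-- The spokes are shared by two faces each, which is what saves vertices.  All lengths are linear
-- forms in r and in the number i of the block within its series, so their distinctness reduces to
-- comparing coefficients and to residues modulo small numbers.

module Submission where

open import Defs hiding (sym)
open import Data.Bool using (Bool; true; false; _∧_; _∨_; not; if_then_else_; T)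
open import Data.Bool.ListAction using (all; any)
open import Data.Bool.Properties using (∨-comm; T-≡)
open import Data.Fin using (Fin; toℕ; zero; suc)
open import Data.Fin.Properties using (toℕ<n; toℕ-injective; toℕ-fromℕ<; any?)
open import Data.List using (List; []; _∷_; _++_; map; concatMap; upTo; allFin; tabulate; length)
open import Data.List.Membership.Propositional using (_∈_)
open import Data.List.Membership.Propositional.Properties
  using (∈-upTo⁺; ∈-map⁺; ∈-++⁺ˡ; ∈-++⁺ʳ; ∈-concatMap⁺)
open import Data.List.Properties using (map-cong; map-tabulate)
open import Data.List.Relation.Unary.Any as Any using (here; there)
open import Data.Nat
open import Data.Nat.Divisibility using (∣m⇒∣m*n; m%n≡0⇒n∣m)
open import Data.Nat.DivMod using (_%_; %-remove-+ʳ)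
open import Data.Nat.ListAction using (sum)
open import Data.Nat.Properties
open import Data.Nat.Tactic.RingSolver using (solve-∀)
open import Data.Product using (Σ; ∃; ∃₂; _×_; _,_; proj₁; proj₂)
open import Data.Sum using (_⊎_; inj₁; inj₂)
open import Function using (_∘_; id; Equivalence)
open import Relation.Binary.Definitions using (tri<; tri≈; tri>)
open import Relation.Binary.PropositionalEquality hiding ([_])
open import Relation.Nullary using (¬_; yes; no; contradiction)

-- Every vertex but the hub has one edge to its parent and each of the first `N` segments adds one
-- edge to the hub, so n vertices carry n - 1 + N edges. A segment closes exactly one face or
-- separate cycle, which gives N = 32 t. The obstacle is the remaining cycles of the fans. If every
-- face grows by 1 with i, a cycle around k neighbouring faces grows by k. Its lengths are therefore
-- sparse, and several such families may share a range as long as they occupy different classes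
-- modulo k. At most 11 faces of this kind are merged, and 27720 is the least common multiple of 1,
-- ..., 12, so t has the same residue modulo each of these numbers whatever r is. What remains is a
-- comparison of finitely many coefficients, which evaluation settles for all r and i at once.

≡ᵇ-refl : ∀ n → (n ≡ᵇ n) ≡ true
≡ᵇ-refl zero    = refl
≡ᵇ-refl (suc n) = ≡ᵇ-refl n

≡ᵇ-true⇒≡ : ∀ {m n} → (m ≡ᵇ n) ≡ true → m ≡ n
≡ᵇ-true⇒≡ {m} {n} e = ≡ᵇ⇒≡ m n (subst T (sym e) _)

≢⇒≡ᵇ-false : ∀ {m n} → m ≢ n → (m ≡ᵇ n) ≡ false
≢⇒≡ᵇ-false {m} {n} m≢n with m ≡ᵇ n in e
... | true  = contradiction (≡ᵇ-true⇒≡ e) m≢n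
... | false = refl

<ᵇ-true⇒< : ∀ {m n} → (m <ᵇ n) ≡ true → m < n
<ᵇ-true⇒< {m} {n} e = <ᵇ⇒< m n (subst T (sym e) _)

<⇒<ᵇ-true : ∀ {m n} → m < n → (m <ᵇ n) ≡ true
<⇒<ᵇ-true m<n = Equivalence.to T-≡ (<⇒<ᵇ m<n)

≮⇒<ᵇ-false : ∀ {m n} → ¬ m < n → (m <ᵇ n) ≡ false
≮⇒<ᵇ-false {m} {n} m≮n with m <ᵇ n in e
... | true  = contradiction (<ᵇ-true⇒< e) m≮n
... | false = refl

∧-true⁻ : ∀ {a b} → a ∧ b ≡ true → a ≡ true × b ≡ true
∧-true⁻ {true} {true} _ = refl , refl

∨-true⁻ : ∀ {a b} → a ∨ b ≡ true → a ≡ true ⊎ b ≡ true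
∨-true⁻ {true}  _ = inj₁ refl
∨-true⁻ {false} e = inj₂ e

[_] : Bool → ℕ
[ b ] = if b then 1 else 0

-- Finite sums

∑ : ℕ → (ℕ → ℕ) → ℕ
∑ zero    f = 0
∑ (suc n) f = f 0 + ∑ n (f ∘ suc)

sum-allFin : ∀ n (f : ℕ → ℕ) → sum (map (λ i → f (toℕ i)) (allFin n)) ≡ ∑ n f
sum-allFin n f = trans (cong sum (map-tabulate {n = n} id (f ∘ toℕ))) (go n f)
  where
  go : ∀ n f → sum (tabulate {n = n} (f ∘ toℕ)) ≡ ∑ n f
  go zero    f = refl
  go (suc n) f = cong (f 0 +_) (go n (f ∘ suc))

∑-cong : ∀ n {f g : ℕ → ℕ} → (∀ i → i < n → f i ≡ g i) → ∑ n f ≡ ∑ n g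
∑-cong zero    e = refl
∑-cong (suc n) e = cong₂ _+_ (e 0 z<s) (∑-cong n λ i i<n → e (suc i) (s≤s i<n))

∑-last : ∀ n f → ∑ (suc n) f ≡ ∑ n f + f n
∑-last zero    f = +-comm (f 0) 0
∑-last (suc n) f = trans (cong (f 0 +_) (∑-last n (f ∘ suc))) (sym (+-assoc (f 0) _ _))

+-interchange : ∀ a b c d → (a + b) + (c + d) ≡ (a + c) + (b + d)
+-interchange = solve-∀

∑-+ : ∀ n f g → ∑ n (λ i → f i + g i) ≡ ∑ n f + ∑ n g
∑-+ zero    f g = refl
∑-+ (suc n) f g = trans (cong (f 0 + g 0 +_) (∑-+ n (f ∘ suc) (g ∘ suc)))
                        (+-interchange (f 0) (g 0) _ _)

∑-zero : ∀ n → ∑ n (λ _ → 0) ≡ 0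
∑-zero zero    = refl
∑-zero (suc n) = ∑-zero n

∑-one : ∀ n → ∑ n (λ _ → 1) ≡ n
∑-one zero    = refl
∑-one (suc n) = cong suc (∑-one n)

∑-swap : ∀ m n (f : ℕ → ℕ → ℕ) → ∑ m (λ i → ∑ n (f i)) ≡ ∑ n (λ j → ∑ m (λ i → f i j))
∑-swap zero    n f = sym (∑-zero n)
∑-swap (suc m) n f = trans (cong (∑ n (f 0) +_) (∑-swap m n (f ∘ suc)))
                           (sym (∑-+ n (f 0) (λ j → ∑ m (λ i → f (suc i) j))))

∑-indicator : ∀ n a → a < n → ∑ n (λ i → [ i ≡ᵇ a ]) ≡ 1
∑-indicator (suc n) zero    _         = cong suc (∑-zero n)
∑-indicator (suc n) (suc a) (s≤s a<n) = ∑-indicator n a a<n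

-- Vertex 0 is the hub.  The remaining vertices are cut into segments k = 0, 1, …: first γ k + 1
-- rim vertices, then σ k spoke vertices, forming a path.  The segment hangs from the hub if it is
-- fresh, and from the last rim vertex of the previous segment otherwise.  The last vertex of each
-- of the segments k < N is also joined to the hub.
module Tree (γ σ : ℕ → ℕ) (fresh : ℕ → Bool) (N : ℕ)
            (ℓ≥1 : ∀ k → k < N → 1 ≤ γ k + σ k) where

  ℓ : ℕ → ℕ
  ℓ k = γ k + σ k

  base : ℕ → ℕ
  base zero    = 0
  base (suc k) = suc (base k + ℓ k)

  vtx : ℕ → ℕ → ℕ
  vtx k o = suc (base k + o)

  next : ℕ × ℕ → ℕ × ℕ
  next (k , o) = if o ≡ᵇ ℓ k then (suc k , 0) else (k , suc o)

  coord : ℕ → ℕ × ℕ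
  coord zero    = 0 , 0
  coord (suc v) = next (coord v)

  next-inner : ∀ {k o} → o < ℓ k → next (k , o) ≡ (k , suc o)
  next-inner o<ℓ rewrite ≢⇒≡ᵇ-false (<⇒≢ o<ℓ) = refl

  next-last : ∀ k → next (k , ℓ k) ≡ (suc k , 0)
  next-last k rewrite ≡ᵇ-refl (ℓ k) = refl

  coord-vtx : ∀ k o → o ≤ ℓ k → coord (base k + o) ≡ (k , o)
  coord-vtx zero    zero    _   = refl
  coord-vtx (suc k) zero    _   rewrite +-identityʳ (base k + ℓ k) =
    trans (cong next (coord-vtx k (ℓ k) ≤-refl)) (next-last k)
  coord-vtx k       (suc o) o<ℓ rewrite +-suc (base k) o =
    trans (cong next (coord-vtx k o (<⇒≤ o<ℓ))) (next-inner o<ℓ)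

  vtx-view : ∀ v → ∃₂ λ k o → o ≤ ℓ k × v ≡ base k + o
  vtx-view zero = 0 , 0 , z≤n , refl
  vtx-view (suc v) with vtx-view v
  ... | k , o , o≤ℓ , refl with m≤n⇒m<n∨m≡n o≤ℓ
  ...   | inj₁ o<ℓ  = k , suc o , o<ℓ , sym (+-suc (base k) o)
  ...   | inj₂ refl = suc k , 0 , z≤n , sym (+-identityʳ (suc (base k + o)))

  attach : ℕ → ℕ
  attach zero    = 0
  attach (suc k) = if fresh (suc k) then 0 else vtx k (γ k)

  par′ : ℕ × ℕ → ℕ
  par′ (k , zero)  = attach k
  par′ (k , suc o) = vtx k o

  par : ℕ → ℕ
  par zero    = 0
  par (suc v) = par′ (coord v)

  end′ : ℕ × ℕ → Bool
  end′ (k , o) = (o ≡ᵇ ℓ k) ∧ (k <ᵇ N)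

  end : ℕ → Bool
  end zero    = false
  end (suc v) = end′ (coord v)

  par-suc : ∀ k o → suc o ≤ ℓ k → par (vtx k (suc o)) ≡ vtx k o
  par-suc k o o<ℓ = cong par′ (coord-vtx k (suc o) o<ℓ)

  par-zero : ∀ k → par (vtx k 0) ≡ attach k
  par-zero k = cong par′ (coord-vtx k 0 z≤n)

  attach≤base : ∀ k → attach k ≤ base k
  attach≤base zero    = z≤n
  attach≤base (suc k) with fresh (suc k)
  ... | true  = z≤n
  ... | false = s≤s (+-monoʳ-≤ (base k) (m≤m+n (γ k) (σ k)))

  par-< : ∀ v → par (suc v) < suc v
  par-< v with vtx-view v
  ... | k , zero  , o≤ℓ , refl =
    subst (_< vtx k 0) (sym (par-zero k)) (s≤s (≤-trans (attach≤base k) (m≤m+n (base k) 0)))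
  ... | k , suc o , o≤ℓ , refl =
    subst (_< vtx k (suc o)) (sym (par-suc k o o≤ℓ)) (s≤s (≤-reflexive (sym (+-suc (base k) o))))

  tip : ℕ → ℕ
  tip k = vtx k (ℓ k)

  end⁻ : ∀ v → end v ≡ true → ∃ λ k → k < N × v ≡ tip k
  end⁻ (suc v) e with vtx-view v
  ... | k , o , o≤ℓ , refl rewrite coord-vtx k o o≤ℓ with ∧-true⁻ {o ≡ᵇ ℓ k} e
  ...   | p , q = k , <ᵇ-true⇒< q , cong (vtx k) (≡ᵇ-true⇒≡ p)

  -- By `ℓ≥1` a tip is not the first vertex of its segment, so its edge to the hub never coincides
  -- with its parent edge.
  par-end≢0 : ∀ v → end v ≡ true → par v ≢ 0
  par-end≢0 v e pv≡0 with end⁻ v e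
  ... | k , k<N , refl with ℓ k in eq | ℓ≥1 k k<N
  ...   | suc o | _ with () ← trans (sym (par-suc k o (≤-reflexive (sym eq)))) pv≡0

  low : ℕ → ℕ → Bool
  low u v = (u <ᵇ v) ∧ ((u ≡ᵇ par v) ∨ ((u ≡ᵇ 0) ∧ end v))

  low⁻ : ∀ u v → low u v ≡ true → u < v × (u ≡ par v ⊎ (u ≡ 0 × end v ≡ true))
  low⁻ u v e with ∧-true⁻ {u <ᵇ v} e
  ... | p , q with ∨-true⁻ {u ≡ᵇ par v} q
  ...   | inj₁ a = <ᵇ-true⇒< p , inj₁ (≡ᵇ-true⇒≡ a)
  ...   | inj₂ b = <ᵇ-true⇒< p , inj₂ (≡ᵇ-true⇒≡ (proj₁ (∧-true⁻ b)) , proj₂ (∧-true⁻ {u ≡ᵇ 0} b))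

  low-irrefl : ∀ u → low u u ≡ false
  low-irrefl u rewrite ≮⇒<ᵇ-false (n≮n u) = refl

  graph : ∀ n → Graph n
  graph n = record
    { adj    = λ i j → low (toℕ i) (toℕ j) ∨ low (toℕ j) (toℕ i)
    ; sym    = λ i j → ∨-comm (low (toℕ i) (toℕ j)) (low (toℕ j) (toℕ i))
    ; irrefl = λ i → cong₂ _∨_ (low-irrefl (toℕ i)) (low-irrefl (toℕ i))
    }

  -- The number of edges

  edge-below : ∀ u v → [ (low u v ∨ low v u) ∧ (u <ᵇ v) ] ≡ [ low u v ]
  edge-below u v with u <? v
  ... | yes u<v rewrite <⇒<ᵇ-true u<v | ≮⇒<ᵇ-false (<⇒≯ u<v)
      with (u ≡ᵇ par v) ∨ ((u ≡ᵇ 0) ∧ end v)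
  ...   | true  = refl
  ...   | false = refl
  edge-below u v | no u≮v rewrite ≮⇒<ᵇ-false u≮v with low v u
  ...   | true  = refl
  ...   | false = refl

  -- The two reasons for an edge exclude each other by `par-end≢0`, so the disjunction becomes a
  -- sum.
  [low] : ∀ u v → [ low u (suc v) ] ≡ [ u ≡ᵇ par (suc v) ] + (if end (suc v) then [ u ≡ᵇ 0 ] else 0)
  [low] u v with u ≡ᵇ par (suc v) in e
  [low] u v | true with refl ← ≡ᵇ-true⇒≡ {u} e rewrite <⇒<ᵇ-true (par-< v) with end (suc v) in m
  ... | false = refl
  ... | true rewrite ≢⇒≡ᵇ-false (par-end≢0 (suc v) m) = refl
  [low] zero v | false with end (suc v)
  ... | true  = refl
  ... | false = refl
  [low] (suc u) v | false with u <ᵇ v | end (suc v)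
  ... | true  | true  = refl
  ... | true  | false = refl
  ... | false | true  = refl
  ... | false | false = refl

  -- Each edge is charged to its larger endpoint, which pays for its parent edge and, at a tip, for
  -- the edge to the hub.
  degree-below : ∀ n v → suc v < n → ∑ n (λ u → [ low u (suc v) ]) ≡ suc [ end (suc v) ]
  degree-below (suc n) v v<n = begin
    ∑ (suc n) (λ u → [ low u (suc v) ])
      ≡⟨ ∑-cong (suc n) (λ u _ → [low] u v) ⟩
    ∑ (suc n) (λ u → [ u ≡ᵇ par (suc v) ] + at u)
      ≡⟨ ∑-+ (suc n) (λ u → [ u ≡ᵇ par (suc v) ]) at ⟩
    ∑ (suc n) (λ u → [ u ≡ᵇ par (suc v) ]) + ∑ (suc n) at
      ≡⟨ cong₂ _+_ (∑-indicator (suc n) (par (suc v)) (<-trans (par-< v) v<n)) hub ⟩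
    suc [ end (suc v) ] ∎
    where
    open ≡-Reasoning
    at : ℕ → ℕ
    at u = if end (suc v) then [ u ≡ᵇ 0 ] else 0
    hub : ∑ (suc n) at ≡ [ end (suc v) ]
    hub with end (suc v)
    ... | true  = cong suc (∑-zero n)
    ... | false = ∑-zero n

  -- `coord v` locates vertex v + 1, so its segment number counts the segments completed by the
  -- vertices 1, ..., v; those from `N` on have no edge from the tip to the hub.
  ends-below : ∀ v → ∑ v (λ u → [ end (suc u) ]) ≡ proj₁ (coord v) ⊓ N
  ends-below zero    = refl
  ends-below (suc v) = begin
    ∑ (suc v) (λ u → [ end (suc u) ])               ≡⟨ ∑-last v (λ u → [ end (suc u) ]) ⟩
    ∑ v (λ u → [ end (suc u) ]) + [ end (suc v) ]   ≡⟨ cong (_+ [ end (suc v) ]) (ends-below v) ⟩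
    proj₁ (coord v) ⊓ N + [ end′ (coord v) ]        ≡⟨ step (coord v) ⟩
    proj₁ (next (coord v)) ⊓ N                      ∎
    where
    open ≡-Reasoning
    step : ∀ c → proj₁ c ⊓ N + [ end′ c ] ≡ proj₁ (next c) ⊓ N
    step (k , o) with o ≡ᵇ ℓ k
    ... | false = +-identityʳ _
    ... | true with k <? N
    ...   | yes k<N rewrite <⇒<ᵇ-true k<N | m≤n⇒m⊓n≡m (<⇒≤ k<N) | m≤n⇒m⊓n≡m k<N = +-comm k 1
    ...   | no  k≮N rewrite ≮⇒<ᵇ-false k≮N | m≥n⇒m⊓n≡n (≮⇒≥ k≮N)
                          | m≥n⇒m⊓n≡n (m≤n⇒m≤1+n (≮⇒≥ k≮N)) = +-identityʳ N

  base-mono : ∀ {j k} → j ≤ k → base j ≤ base k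
  base-mono {k = zero}  z≤n = z≤n
  base-mono {j} {suc k} j≤k with m≤n⇒m<n∨m≡n j≤k
  ... | inj₂ refl      = ≤-refl
  ... | inj₁ (s≤s j≤k) = ≤-trans (base-mono j≤k) (≤-trans (m≤m+n (base k) (ℓ k)) (n≤1+n _))

  tip<vtx : ∀ {j k} o → j < k → tip j < vtx k o
  tip<vtx {k = k} o j<k = s≤s (≤-trans (base-mono j<k) (m≤m+n (base k) o))

  numEdges-graph : ∀ n → base N ≤ n → numEdges (graph (suc n)) ≡ n + N
  numEdges-graph n N≤n = begin
    numEdges (graph (suc n))
      ≡⟨ sum-allFin′ (suc n) _ (λ u → ∑ (suc n) (edge u)) (λ i → sum-allFin (suc n) (edge (toℕ i))) ⟩
    ∑ (suc n) (λ u → ∑ (suc n) (edge u))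
      ≡⟨ ∑-cong (suc n) (λ u _ → ∑-cong (suc n) (λ v _ → edge-below u v)) ⟩
    ∑ (suc n) (λ u → ∑ (suc n) (λ v → [ low u v ]))
      ≡⟨ ∑-swap (suc n) (suc n) (λ u v → [ low u v ]) ⟩
    ∑ (suc n) (λ u → [ low u 0 ]) + ∑ n (λ v → ∑ (suc n) (λ u → [ low u (suc v) ]))
      ≡⟨ cong₂ _+_ (∑-zero (suc n))
                   (∑-cong n (λ v v<n → degree-below (suc n) v (s≤s v<n))) ⟩
    ∑ n (λ v → 1 + [ end (suc v) ])
      ≡⟨ ∑-+ n (λ _ → 1) (λ v → [ end (suc v) ]) ⟩
    ∑ n (λ _ → 1) + ∑ n (λ v → [ end (suc v) ])
      ≡⟨ cong₂ _+_ (∑-one n) (trans (ends-below n) (m≥n⇒m⊓n≡n N≤coord)) ⟩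
    n + N ∎
    where
    open ≡-Reasoning
    edge : ℕ → ℕ → ℕ
    edge u v = [ (low u v ∨ low v u) ∧ (u <ᵇ v) ]
    sum-allFin′ : ∀ n (f : Fin n → ℕ) (g : ℕ → ℕ) → (∀ i → f i ≡ g (toℕ i)) →
                  sum (map f (allFin n)) ≡ ∑ n g
    sum-allFin′ n f g e = trans (cong sum (map-cong e (allFin n))) (sum-allFin n g)
    N≤coord : N ≤ proj₁ (coord n)
    N≤coord with vtx-view n
    ... | k , o , o≤ℓ , refl rewrite coord-vtx k o o≤ℓ =
      ≮⇒≥ λ k<N → <⇒≱ (≤-<-trans (+-monoʳ-≤ (base k) o≤ℓ) (base-mono k<N)) N≤n

-- Cycles as closed walks from a chosen vertex

cnext-suc : ∀ {m} (i : Fin (suc m)) → suc (toℕ i) < suc m → toℕ (cnext i) ≡ suc (toℕ i)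
cnext-suc {m} i i<m with suc (toℕ i) <? suc m
... | yes p  = toℕ-fromℕ< p
... | no i≮m = contradiction i<m i≮m

cnext-last : ∀ {m} (i : Fin (suc m)) → suc (toℕ i) ≡ suc m → toℕ (cnext i) ≡ 0
cnext-last {m} i i≡m with suc (toℕ i) <? suc m
... | yes p = contradiction i≡m (<⇒≢ p)
... | no _  = refl

module Rotation {m : ℕ} (i₀ : Fin (suc m)) where

  rot : ℕ → Fin (suc m)
  rot zero    = i₀
  rot (suc k) = cnext (rot k)

  private
    -- After `b` steps the walk wraps around to index 0; `before` and `after` give the index on
    -- either side of that moment.
    a b : ℕ
    a = toℕ i₀
    b = suc m ∸ a

    a+b≡ : a + b ≡ suc m
    a+b≡ = m+[n∸m]≡n (<⇒≤ (toℕ<n i₀))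

    b+a≡ : b + a ≡ suc m
    b+a≡ = trans (+-comm b a) a+b≡

    0<b : 0 < b
    0<b = m<n⇒0<n∸m (toℕ<n i₀)

    before : ∀ k → k < b → toℕ (rot k) ≡ a + k
    before zero    _   = sym (+-identityʳ a)
    before (suc k) k<b = trans (cnext-suc (rot k) lt) (trans (cong suc ih) (sym (+-suc a k)))
      where
      ih = before k (<⇒≤ k<b)
      lt : suc (toℕ (rot k)) < suc m
      lt = subst₂ _<_ (trans (+-suc a k) (cong suc (sym ih))) a+b≡ (+-monoʳ-< a k<b)

    after : ∀ k → k ≤ a → toℕ (rot (b + k)) ≡ k
    after zero _ with b | 0<b | before | a+b≡
    ... | suc b′ | _ | bef | eq = trans (cong (toℕ ∘ rot) (+-identityʳ (suc b′)))
      (cnext-last (rot b′) (trans (cong suc (bef b′ ≤-refl)) (trans (sym (+-suc a b′)) eq)))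
    after (suc k) k<a = trans (cong (toℕ ∘ rot) (+-suc b k)) (trans (cnext-suc (rot (b + k)) lt) (cong suc ih))
      where
      ih = after k (<⇒≤ k<a)
      lt : suc (toℕ (rot (b + k))) < suc m
      lt = subst (λ x → suc x < suc m) (sym ih) (≤-<-trans k<a (toℕ<n i₀))

    split : ∀ k → k < suc m → k < b ⊎ ∃ λ e → e < a × k ≡ b + e
    split k k<L with k <? b
    ... | yes k<b = inj₁ k<b
    ... | no  k≮b = inj₂ (k ∸ b , +-cancelˡ-< b (k ∸ b) a (subst₂ _<_ (sym k≡) (sym b+a≡) k<L) , sym k≡)
      where k≡ = m+[n∸m]≡n (≮⇒≥ k≮b)

  rot-period : rot (suc m) ≡ i₀
  rot-period = toℕ-injective (trans (cong (toℕ ∘ rot) (sym b+a≡)) (after a ≤-refl))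

  rot-injective : ∀ k l → k < suc m → l < suc m → rot k ≡ rot l → k ≡ l
  rot-injective k l k<L l<L e with split k k<L | split l l<L
  ... | inj₁ p | inj₁ q =
    +-cancelˡ-≡ a k l (trans (sym (before k p)) (trans (cong toℕ e) (before l q)))
  ... | inj₂ (x , p , refl) | inj₂ (y , q , refl) =
    cong (b +_) (trans (sym (after x (<⇒≤ p))) (trans (cong toℕ e) (after y (<⇒≤ q))))
  ... | inj₁ p | inj₂ (y , q , refl) =
    contradiction (trans (sym (after y (<⇒≤ q))) (trans (cong toℕ (sym e)) (before k p)))
                  (<⇒≢ (<-≤-trans q (m≤m+n a k)))
  ... | inj₂ (x , p , refl) | inj₁ q =
    contradiction (trans (sym (after x (<⇒≤ p))) (trans (cong toℕ e) (before l q)))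
                  (<⇒≢ (<-≤-trans p (m≤m+n a l)))

  rot-surjective : ∀ i → ∃ λ k → k < suc m × rot k ≡ i
  rot-surjective i with toℕ i <? a
  ... | yes i<a = b + toℕ i , subst (b + toℕ i <_) b+a≡ (+-monoʳ-< b i<a) ,
                  toℕ-injective (after (toℕ i) (<⇒≤ i<a))
  ... | no  i≮a = toℕ i ∸ a , ≤-<-trans (m∸n≤m (toℕ i) a) (toℕ<n i) ,
                  toℕ-injective (trans (before (toℕ i ∸ a) lt) i≡)
    where
    i≡ = m+[n∸m]≡n (≮⇒≥ i≮a)
    lt : toℕ i ∸ a < b
    lt = +-cancelˡ-< a (toℕ i ∸ a) b (subst₂ _<_ (sym i≡) (sym a+b≡) (toℕ<n i))

open Rotation

-- A cycle has at least three vertices, so it never steps straight back; `turn` relies on this.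
cnext²≢ : ∀ {m} → 2 ≤ m → (i : Fin (suc m)) → cnext (cnext i) ≢ i
cnext²≢ 2≤m i e with () ← rot-injective i 2 0 (s≤s 2≤m) z<s e

Same : ℕ → ℕ → ℕ → ℕ → Set
Same y z p q = (p ≡ y × q ≡ z) ⊎ (p ≡ z × q ≡ y)

Same-sym : ∀ {y z p q} → Same y z p q → Same p q y z
Same-sym (inj₁ (e , f)) = inj₁ (sym e , sym f)
Same-sym (inj₂ (e , f)) = inj₂ (sym f , sym e)

Same-trans : ∀ {y z p q r s} → Same y z p q → Same p q r s → Same y z r s
Same-trans (inj₁ (refl , refl)) t               = t
Same-trans (inj₂ (refl , refl)) (inj₁ (e , f)) = inj₂ (e , f)
Same-trans (inj₂ (refl , refl)) (inj₂ (e , f)) = inj₁ (e , f)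

-- single k is the cycle through the tip of segment k and the first vertex of its block, and
-- pair j d is the cycle through the tips of the segments j and suc (d + j).
data Code : Set where
  single : ℕ → Code
  pair   : ℕ → ℕ → Code

module Cycles (γ σ : ℕ → ℕ) (fresh : ℕ → Bool) (N : ℕ)
              (ℓ≥1 : ∀ k → k < N → 1 ≤ γ k + σ k) where

  open Tree γ σ fresh N ℓ≥1

  -- Ancestors and walks in the forest

  up : ℕ → ℕ → ℕ
  up zero    v = v
  up (suc x) v = up x (par v)

  up-suc : ∀ x v → up (suc x) v ≡ par (up x v)
  up-suc zero    v = refl
  up-suc (suc x) v = up-suc x (par v)

  up-+ : ∀ x y v → up (x + y) v ≡ up y (up x v)
  up-+ zero    y v = refl
  up-+ (suc x) y v = up-+ x y (par v)

  up-zero : ∀ x → up x 0 ≡ 0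
  up-zero zero    = refl
  up-zero (suc x) = up-zero x

  par-≤ : ∀ v → par v ≤ v
  par-≤ zero    = z≤n
  par-≤ (suc v) = <⇒≤ (par-< v)

  up-≤ : ∀ x v → up x v ≤ v
  up-≤ zero    v = ≤-refl
  up-≤ (suc x) v = ≤-trans (up-≤ x (par v)) (par-≤ v)

  up-≢ : ∀ x v → up (suc x) v ≢ 0 → up (suc x) v ≢ v
  up-≢ x zero    ≢0 = contradiction (up-zero x) ≢0
  up-≢ x (suc v) ≢0 = <⇒≢ (≤-<-trans (up-≤ x (par (suc v))) (par-< v))

  -- `par` strictly lowers the number of a vertex until the hub is reached, so only the hub can
  -- recur among the ancestors.
  up-injective : ∀ x y v → up x v ≡ up y v → up x v ≢ 0 → x ≡ y
  up-injective zero    zero    v e ≢0 = refl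
  up-injective zero    (suc y) v e ≢0 = contradiction (sym e) (up-≢ y v (≢0 ∘ trans e))
  up-injective (suc x) zero    v e ≢0 = contradiction e (up-≢ x v ≢0)
  up-injective (suc x) (suc y) v e ≢0 = cong suc (up-injective x y (par v) e ≢0)

  -- A step from a vertex down to its child can only be undone by stepping straight back, since the
  -- parent is unique. A walk in the forest without such reversals climbs up to some time `a` and
  -- descends from then on.
  turn : ∀ (f : ℕ → ℕ) K →
         (∀ k → k < K → par (f k) ≡ f (suc k) ⊎ par (f (suc k)) ≡ f k) →
         (∀ k → suc k < K → f k ≢ f (suc (suc k))) →
         ∃ λ a → a ≤ K × (∀ k → k < a → par (f k) ≡ f (suc k)) ×
                 (∀ k → a ≤ k → k < K → par (f (suc k)) ≡ f k)
  turn f zero step ≢2 = 0 , z≤n , (λ _ ()) , (λ _ _ ())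
  turn f (suc K) step ≢2
    with turn f K (λ k k<K → step k (m≤n⇒m≤1+n k<K)) (λ k k<K → ≢2 k (m≤n⇒m≤1+n k<K)) | step K ≤-refl
  ... | a , a≤K , ups , downs | inj₂ down = a , m≤n⇒m≤1+n a≤K , ups , downs′
    where
    downs′ : ∀ k → a ≤ k → k < suc K → par (f (suc k)) ≡ f k
    downs′ k a≤k (s≤s k≤K) with m≤n⇒m<n∨m≡n k≤K
    ... | inj₁ k<K  = downs k a≤k k<K
    ... | inj₂ refl = down
  ... | a , a≤K , ups , downs | inj₁ upK with m≤n⇒m<n∨m≡n a≤K
  ...   | inj₂ refl = suc K , ≤-refl , ups′ , λ k K<k k<K → contradiction k<K (≤⇒≯ K<k)
    where
    ups′ : ∀ k → k < suc K → par (f k) ≡ f (suc k)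
    ups′ k (s≤s k≤K) with m≤n⇒m<n∨m≡n k≤K
    ... | inj₁ k<K  = ups k k<K
    ... | inj₂ refl = upK
  turn f (suc (suc K)) step ≢2 | a , a≤K , ups , downs | inj₁ upK | inj₁ (s≤s a≤K′) =
    contradiction (trans (sym (downs K a≤K′ ≤-refl)) upK) (≢2 K ≤-refl)

  -- The form of a cycle

  Near : ℕ → Set
  Near u = end u ≡ true ⊎ par u ≡ 0

  -- These are the edges of the cycle in terms of `u`, `a`, `v`, `b` alone, so that cycles with
  -- equal data have equal edge sets.
  data Arc (u a v b : ℕ) : ℕ → ℕ → Set where
    hubˡ  : Arc u a v b 0 u
    hubʳ  : Arc u a v b 0 v
    left  : ∀ x → x < a → Arc u a v b (up x u) (up (suc x) u)
    right : ∀ y → y < b → Arc u a v b (up y v) (up (suc y) v)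

  Arc-swap : ∀ {u a v b p q} → Arc u a v b p q → Arc v b u a p q
  Arc-swap hubˡ        = hubʳ
  Arc-swap hubʳ        = hubˡ
  Arc-swap (left x p)  = right x p
  Arc-swap (right y p) = left y p

  record Shape {n} (C : Cycle (graph n)) (u a v b : ℕ) : Set where
    field
      len≡   : len C ≡ suc (suc (a + b))
      top≢0  : up a u ≢ 0
      meet   : up a u ≡ up b v
      -- Comparing the vertices just below the top is enough to make the top the lowest common
      -- ancestor, since climbs that have met stay together.
      apart  : ∀ x y → a ≡ suc x → b ≡ suc y → up x u ≢ up y v
      u≢v    : u ≢ v
      nearˡ  : Near u
      nearʳ  : Near v
      edge⇒  : ∀ y z → CycleEdge C y z → ∃₂ λ p q → Arc u a v b p q × Same (toℕ y) (toℕ z) p q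
      edge⇐  : ∀ y z p q → Arc u a v b p q → Same (toℕ y) (toℕ z) p q → CycleEdge C y z

  Shape-swap : ∀ {n} {C : Cycle (graph n)} {u a v b} → Shape C u a v b → Shape C v b u a
  Shape-swap {a = a} {b = b} S = record
    { len≡   = trans len≡ (cong (λ x → suc (suc x)) (+-comm a b))
    ; top≢0  = top≢0 ∘ trans meet
    ; meet   = sym meet
    ; apart  = λ x y p q → apart y x q p ∘ sym
    ; u≢v    = u≢v ∘ sym
    ; nearˡ  = nearʳ
    ; nearʳ  = nearˡ
    ; edge⇒  = λ y z e → let p , q , arc , s = edge⇒ y z e in p , q , Arc-swap arc , s
    ; edge⇐  = λ y z p q arc → edge⇐ y z p q (Arc-swap arc)
    } where open Shape S

  link : ∀ u v → low u v ∨ low v u ≡ true → u ≢ 0 → v ≢ 0 → par u ≡ v ⊎ par v ≡ u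
  link u v e u≢0 v≢0 with ∨-true⁻ {low u v} e
  link u v e u≢0 v≢0 | inj₁ l with low⁻ u v l
  ... | _ , inj₁ p       = inj₂ (sym p)
  ... | _ , inj₂ (p , _) = contradiction p u≢0
  link u v e u≢0 v≢0 | inj₂ l with low⁻ v u l
  ... | _ , inj₁ p       = inj₁ (sym p)
  ... | _ , inj₂ (p , _) = contradiction p v≢0

  near : ∀ v → low 0 v ∨ low v 0 ≡ true → Near v
  near v e with ∨-true⁻ {low 0 v} e
  ... | inj₁ l with low⁻ 0 v l
  ...   | _ , inj₁ p       = inj₂ (sym p)
  ...   | _ , inj₂ (_ , p) = inj₁ p

  module _ {n} (C : Cycle (graph n)) where

    L : ℕ
    L = len C

    descent : ∀ (f : ℕ → ℕ) K → (∀ k → f k ≢ 0) → (∀ k → k < K → par (f k) ≡ f (suc k)) →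
              f K ≤ f 0
    descent f zero    ≢0 ups = ≤-refl
    descent f (suc K) ≢0 ups = ≤-trans
      (subst (_≤ f K) (ups K ≤-refl) (par-≤ (f K)))
      (descent f K ≢0 (λ k k<K → ups k (m≤n⇒m≤1+n k<K)))

    par≡⇒< : ∀ {u v} → u ≢ 0 → par u ≡ v → v < u
    par≡⇒< {zero}  u≢0 e    = contradiction refl u≢0
    par≡⇒< {suc u} u≢0 refl = par-< u

    -- A cycle avoiding the hub would be a walk in the forest. It is followed for two rounds, so
    -- that one full round lies on one side of the turning point; there the vertex numbers change
    -- monotonically, yet the round returns to its start.
    hub-in-cycle : ∃ λ i → toℕ (vert C i) ≡ 0
    hub-in-cycle with any? (λ i → toℕ (vert C i) ≟ 0)
    ... | yes p = p
    ... | no ¬p = contradiction monotone no-monotone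
      where
      R : ℕ → Fin L
      R = rot zero
      f : ℕ → ℕ
      f k = toℕ (vert C (R k))
      ≢0 : ∀ k → f k ≢ 0
      ≢0 k e = ¬p (R k , e)
      R-period : ∀ k → R (k + L) ≡ R k
      R-period zero    = rot-period zero
      R-period (suc k) = cong cnext (R-period k)
      f-period : ∀ k → f (k + L) ≡ f k
      f-period k = cong (toℕ ∘ vert C) (R-period k)
      turned = turn f (L + L) (λ k _ → link (f k) (f (suc k)) (isAdj C (R k)) (≢0 k) (≢0 (suc k)))
        (λ k _ e → cnext²≢ (m≥2 C) (R k) (inj C (toℕ-injective (sym e))))
      Monotone = (∀ k → k < L → par (f k) ≡ f (suc k)) ⊎
                 (∀ k → k < L → par (f (suc k + L)) ≡ f (k + L))
      monotone : Monotone
      monotone with turned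
      ... | a , _ , ups , downs with ≤-total L a
      ...   | inj₁ L≤a = inj₁ λ k k<L → ups k (<-≤-trans k<L L≤a)
      ...   | inj₂ a≤L = inj₂ λ k k<L → downs (k + L) (≤-trans a≤L (m≤n+m L k)) (+-monoˡ-< L k<L)
      no-monotone : ¬ Monotone
      no-monotone (inj₁ ups) = <⇒≱
        (par≡⇒< (≢0 0) (ups 0 z<s))
        (subst (_≤ f 1) (f-period 0)
          (descent (f ∘ suc) (m C) (≢0 ∘ suc) (λ k k<m → ups (suc k) (s≤s k<m))))
      no-monotone (inj₂ downs) = <⇒≱
        (par≡⇒< (≢0 1) (subst₂ (λ x y → par x ≡ y) (f-period 1) (f-period 0) (downs 0 z<s)))
        (subst (f 1 ≤_) (f-period 0) (rise (m C) (λ k k<m → down (suc k) (s≤s k<m))))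
        where
        down : ∀ k → k < L → par (f (suc k)) ≡ f k
        down k k<L = subst₂ (λ x y → par x ≡ y) (f-period (suc k)) (f-period k) (downs k k<L)
        rise : ∀ K → (∀ k → k < K → par (f (suc (suc k))) ≡ f (suc k)) → f 1 ≤ f (suc K)
        rise zero    d = ≤-refl
        rise (suc K) d = ≤-trans (rise K (λ k k<K → d k (m≤n⇒m≤1+n k<K)))
          (subst (_≤ f (suc (suc K))) (d K ≤-refl) (par-≤ (f (suc (suc K)))))

  -- The cycle read from the hub, as a sequence of numbers; `K` is the number of steps from one
  -- neighbour of the hub to the other.
  record Tour {n} (C : Cycle (graph n)) (K : ℕ) (V : ℕ → ℕ) : Set where
    field
      1≤K         : 1 ≤ K
      len≡        : len C ≡ suc (suc K)
      V0≡0        : V 0 ≡ 0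
      last≡0      : V (suc (suc K)) ≡ 0
      adjacent    : ∀ k → low (V k) (V (suc k)) ∨ low (V (suc k)) (V k) ≡ true
      V-injective : ∀ k l → k ≤ suc K → l ≤ suc K → V k ≡ V l → k ≡ l
      edge⇒       : ∀ y z → CycleEdge C y z → ∃ λ k → k ≤ suc K × Same (toℕ y) (toℕ z) (V k) (V (suc k))
      edge⇐       : ∀ y z k → Same (V k) (V (suc k)) (toℕ y) (toℕ z) → CycleEdge C y z

  tour : ∀ {n} (C : Cycle (graph n)) i₀ → toℕ (vert C i₀) ≡ 0 → ∀ K → m C ≡ suc K →
         Tour C K (λ k → toℕ (vert C (rot i₀ k)))
  tour C i₀ hub K eq = record
    { 1≤K         = s≤s⁻¹ (subst (2 ≤_) eq (m≥2 C))
    ; len≡        = cong suc eq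
    ; V0≡0        = hub
    ; last≡0      = trans (cong (λ k → V (suc k)) (sym eq)) (trans (cong (λ i → toℕ (vert C i)) (rot-period i₀)) hub)
    ; adjacent    = λ k → isAdj C (rot i₀ k)
    ; V-injective = λ k l k≤ l≤ e → rot-injective i₀ k l (s≤s (subst (k ≤_) (sym eq) k≤))
                                      (s≤s (subst (l ≤_) (sym eq) l≤)) (inj C (toℕ-injective e))
    ; edge⇒       = λ y z (i , e) → edge⇒ y z i e (rot-surjective i₀ i)
    ; edge⇐       = λ y z k s → rot i₀ k , edge⇐ y z k s
    }
    where
    V : ℕ → ℕ
    V k = toℕ (vert C (rot i₀ k))
    edge⇒ : ∀ y z i → (vert C i ≡ y × vert C (cnext i) ≡ z) ⊎ (vert C i ≡ z × vert C (cnext i) ≡ y) →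
            (∃ λ k → k < len C × rot i₀ k ≡ i) →
            ∃ λ k → k ≤ suc K × Same (toℕ y) (toℕ z) (V k) (V (suc k))
    edge⇒ y z i e (k , s≤s k≤ , refl) = k , subst (k ≤_) eq k≤ , lift e
      where
      lift : (vert C i ≡ y × vert C (cnext i) ≡ z) ⊎ (vert C i ≡ z × vert C (cnext i) ≡ y) →
             Same (toℕ y) (toℕ z) (V k) (V (suc k))
      lift (inj₁ (p , q)) = inj₁ (cong toℕ p , cong toℕ q)
      lift (inj₂ (p , q)) = inj₂ (cong toℕ p , cong toℕ q)
    edge⇐ : ∀ y z k → Same (V k) (V (suc k)) (toℕ y) (toℕ z) →
            (vert C (rot i₀ k) ≡ y × vert C (cnext (rot i₀ k)) ≡ z) ⊎
            (vert C (rot i₀ k) ≡ z × vert C (cnext (rot i₀ k)) ≡ y)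
    edge⇐ y z k (inj₁ (p , q)) = inj₁ (toℕ-injective (sym p) , toℕ-injective (sym q))
    edge⇐ y z k (inj₂ (p , q)) = inj₂ (toℕ-injective (sym q) , toℕ-injective (sym p))

  -- Between its two visits to the hub the tour walks in the forest, so `turn` splits it; the
  -- descending part read backwards is the climb from `v`.
  shape-of-tour : ∀ {n} {C : Cycle (graph n)} {K V} → Tour C K V → ∃₂ λ u a → ∃₂ λ v b → Shape C u a v b
  shape-of-tour {C = C} {K} {V} tour = u , a , v , b , record
    { len≡   = trans (Tour.len≡ tour) (cong (λ x → suc (suc x)) (sym a+b≡K))
    ; top≢0  = λ e → f≢0 a a≤K (trans (f-left a ≤-refl) e)
    ; meet   = trans (sym (f-left a ≤-refl)) (trans (cong f (sym K∸b≡a)) (f-right b ≤-refl))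
    ; apart  = apart
    ; u≢v    = λ e → <⇒≢ 1≤K (f-injective 0 K z≤n ≤-refl e)
    ; nearˡ  = near u (subst (λ h → low h u ∨ low u h ≡ true) V0≡0 (adjacent 0))
    ; nearʳ  = near v (subst (λ h → low h v ∨ low v h ≡ true) last≡0
                 (trans (∨-comm (low (V (suc (suc K))) v) (low v (V (suc (suc K))))) (adjacent (suc K))))
    ; edge⇒  = λ y z e → let k , k≤ , s = Tour.edge⇒ tour y z e
                             p , q , r , t = arc k k≤
                         in p , q , r , Same-trans s t
    ; edge⇐  = λ y z p q r s → let k , t = arc⁻ p q r
                               in Tour.edge⇐ tour y z k (Same-sym (Same-trans s t))
    }
    where
    open Tour tour using (1≤K; V0≡0; last≡0; adjacent; V-injective)
    f : ℕ → ℕ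
    f k = V (suc k)
    f-injective : ∀ k l → k ≤ K → l ≤ K → f k ≡ f l → k ≡ l
    f-injective k l k≤ l≤ e = suc-injective (V-injective (suc k) (suc l) (s≤s k≤) (s≤s l≤) e)
    f≢0 : ∀ k → k ≤ K → f k ≢ 0
    f≢0 k k≤K e with () ← V-injective (suc k) 0 (s≤s k≤K) z≤n (trans e (sym V0≡0))
    turned = turn f K
      (λ k k<K → link (f k) (f (suc k)) (adjacent (suc k)) (f≢0 k (<⇒≤ k<K)) (f≢0 (suc k) k<K))
      (λ k k<K e → <⇒≢ (≤-trans (n≤1+n (suc k)) ≤-refl)
                        (f-injective k (suc (suc k)) (<⇒≤ (<-trans (n<1+n k) k<K)) k<K e))
    a b u v : ℕ
    a = proj₁ turned
    b = K ∸ a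
    u = f 0
    v = f K
    a≤K   = proj₁ (proj₂ turned)
    ups   = proj₁ (proj₂ (proj₂ turned))
    downs = proj₂ (proj₂ (proj₂ turned))
    a+b≡K : a + b ≡ K
    a+b≡K = m+[n∸m]≡n a≤K
    K∸b≡a : K ∸ b ≡ a
    K∸b≡a = m∸[m∸n]≡n a≤K
    f-left : ∀ x → x ≤ a → f x ≡ up x u
    f-left zero    _   = refl
    f-left (suc x) x<a = trans (sym (ups x x<a)) (trans (cong par (f-left x (<⇒≤ x<a))) (sym (up-suc x u)))
    K∸y : ∀ y → y < b → suc (K ∸ suc y) ≡ K ∸ y
    K∸y y y<b = sym (+-∸-assoc 1 (≤-trans y<b (m∸n≤m K a)))
    a≤K∸ : ∀ y → y < b → a ≤ K ∸ suc y
    a≤K∸ y y<b = subst (_≤ K ∸ suc y) K∸b≡a (∸-monoʳ-≤ K y<b)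
    K∸< : ∀ y → y < b → K ∸ suc y < K
    K∸< y y<b = subst (_≤ K) (sym (K∸y y y<b)) (m∸n≤m K y)
    f-right : ∀ y → y ≤ b → f (K ∸ y) ≡ up y v
    f-right zero    _   = refl
    f-right (suc y) y<b = trans (sym (downs (K ∸ suc y) (a≤K∸ y y<b) (K∸< y y<b)))
      (trans (cong par (trans (cong f (K∸y y y<b)) (f-right y (<⇒≤ y<b)))) (sym (up-suc y v)))
    apart : ∀ x y → a ≡ suc x → b ≡ suc y → up x u ≢ up y v
    apart x y a≡ b≡ e = <⇒≢ lt (f-injective x (K ∸ y) (<⇒≤ (<-≤-trans x<a a≤K)) (m∸n≤m K y)
        (trans (f-left x (<⇒≤ x<a)) (trans e (sym (f-right y (<⇒≤ y<b))))))
      where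
      x<a : x < a
      x<a = ≤-reflexive (sym a≡)
      y<b : y < b
      y<b = ≤-reflexive (sym b≡)
      lt : x < K ∸ y
      lt = <-≤-trans x<a (≤-trans (a≤K∸ y y<b) (∸-monoʳ-≤ K (n≤1+n y)))
    arc : ∀ k → k ≤ suc K → ∃₂ λ p q → Arc u a v b p q × Same (V k) (V (suc k)) p q
    arc zero    _ = 0 , u , hubˡ , inj₁ (sym V0≡0 , refl)
    arc (suc k) (s≤s k≤K) with m≤n⇒m<n∨m≡n k≤K
    ... | inj₂ refl = 0 , v , hubʳ , inj₂ (sym last≡0 , refl)
    ... | inj₁ k<K with k <? a
    ...   | yes k<a = up k u , up (suc k) u , left k k<a ,
              inj₁ (sym (f-left k (<⇒≤ k<a)) , sym (f-left (suc k) k<a))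
    ...   | no  k≮a = up y v , up (suc y) v , right y y<b , inj₂
              ( trans (sym (f-right y (<⇒≤ y<b))) (cong f (m∸[m∸n]≡n k<K))
              , trans (sym (f-right (suc y) y<b)) (cong f K∸suc-y))
      where
      y = K ∸ suc k
      suc-y : suc y ≡ K ∸ k
      suc-y = sym (+-∸-assoc 1 k<K)
      y<b : y < b
      y<b = subst (_≤ b) (sym suc-y) (∸-monoʳ-≤ K (≮⇒≥ k≮a))
      K∸suc-y : K ∸ suc y ≡ k
      K∸suc-y = trans (cong (K ∸_) suc-y) (m∸[m∸n]≡n k≤K)
    arc⁻ : ∀ p q → Arc u a v b p q → ∃ λ k → Same p q (V k) (V (suc k))
    arc⁻ _ _ hubˡ        = 0 , inj₁ (V0≡0 , refl)
    arc⁻ _ _ hubʳ        = suc K , inj₂ (refl , last≡0)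
    arc⁻ _ _ (left x p)  = suc x , inj₁ (f-left x (<⇒≤ p) , f-left (suc x) p)
    arc⁻ _ _ (right y p) = suc (K ∸ suc y) , inj₂
      (f-right (suc y) p , trans (cong f (K∸y y p)) (f-right y (<⇒≤ p)))

  shape : ∀ {n} (C : Cycle (graph n)) → ∃₂ λ u a → ∃₂ λ v b → Shape C u a v b
  shape C with hub-in-cycle C
  ... | i₀ , hub = shape-of-tour (tour C i₀ hub (pred (m C)) (sym (suc-pred (m C) {{>-nonZero (<-trans z<s (m≥2 C))}})))

  -- The segments j and suc (d + j) belong to the same block.
  Joined : ℕ → ℕ → Set
  Joined j zero    = fresh (suc j) ≡ false
  Joined j (suc d) = fresh (suc (suc d + j)) ≡ false × Joined j d

  -- Distances along a block

  -- Steps from the first vertex of a segment to the first vertex of its block.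
  rim : ℕ → ℕ
  rim zero    = 0
  rim (suc k) = if fresh (suc k) then 0 else suc (γ k + rim k)

  -- Steps from the first vertex of segment `suc (d + j)` to the foot of the spoke of segment `j`,
  -- the rim vertex `vtx j (γ j)`.
  climb : ℕ → ℕ → ℕ
  climb j zero    = 1
  climb j (suc d) = suc (γ (suc d + j) + climb j d)

  rim-fresh : ∀ k → fresh (suc k) ≡ true → rim (suc k) ≡ 0
  rim-fresh k e rewrite e = refl

  rim-joined : ∀ k → fresh (suc k) ≡ false → rim (suc k) ≡ suc (γ k + rim k)
  rim-joined k e rewrite e = refl

  par-joined : ∀ k → fresh (suc k) ≡ false → par (vtx (suc k) 0) ≡ vtx k (γ k)
  par-joined k e = trans (par-zero (suc k)) attached
    where
    attached : attach (suc k) ≡ vtx k (γ k)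
    attached rewrite e = refl

  par-fresh : ∀ k → fresh (suc k) ≡ true → par (vtx (suc k) 0) ≡ 0
  par-fresh k e = trans (par-zero (suc k)) attached
    where
    attached : attach (suc k) ≡ 0
    attached rewrite e = refl

  up-vtx : ∀ k o h → o ≤ ℓ k → up (o + h) (vtx k o) ≡ up h (vtx k 0)
  up-vtx k zero    h _   = refl
  up-vtx k (suc o) h o<ℓ = trans (cong (up (o + h)) (par-suc k o o<ℓ)) (up-vtx k o h (<⇒≤ o<ℓ))

  up-spoke : ∀ k s → s ≤ σ k → up s (vtx k (γ k + s)) ≡ vtx k (γ k)
  up-spoke k zero    _   = cong (vtx k) (+-identityʳ (γ k))
  up-spoke k (suc s) s<σ rewrite +-suc (γ k) s =
    trans (cong (up s) (par-suc k (γ k + s) (subst (_≤ ℓ k) (+-suc (γ k) s) (+-monoʳ-≤ (γ k) s<σ))))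
          (up-spoke k s (<⇒≤ s<σ))

  up-spoke> : ∀ k s x → s ≤ σ k → x < s → vtx k (γ k) < up x (vtx k (γ k + s))
  up-spoke> k (suc s) zero    _   _         = s≤s (+-monoʳ-< (base k) (m<m+n (γ k) z<s))
  up-spoke> k (suc s) (suc x) s<σ (s≤s x<s) rewrite +-suc (γ k) s =
    subst (λ v → vtx k (γ k) < up x v)
      (sym (par-suc k (γ k + s) (subst (_≤ ℓ k) (+-suc (γ k) s) (+-monoʳ-≤ (γ k) s<σ))))
      (up-spoke> k s x (<⇒≤ s<σ) x<s)

  along : ∀ {B} k o h → o ≤ ℓ k → B < vtx k 0 → (∀ y → y < h → B < up y (vtx k 0)) →
          ∀ y → y < o + h → B < up y (vtx k o)
  along k zero    h _   B<v P y       y<          = P y y<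
  along k (suc o) h _   B<v P zero    _           = ≤-trans B<v (s≤s (+-monoʳ-≤ (base k) z≤n))
  along {B} k (suc o) h o<ℓ B<v P (suc y) (s≤s y<) =
    subst (λ v → B < up y v) (sym (par-suc k o o<ℓ)) (along k o h (<⇒≤ o<ℓ) B<v P y y<)

  j<1+d+j : ∀ d j → j < suc (d + j)
  j<1+d+j d j = s≤s (m≤n+m j d)

  γ≤ℓ : ∀ k → γ k ≤ ℓ k
  γ≤ℓ k = m≤m+n (γ k) (σ k)

  -- Until its last step the climb stays in segments after `j`, and vertices are numbered segment by
  -- segment.
  climb> : ∀ j d → Joined j d → ∀ y → y < climb j d → tip j < up y (vtx (suc (d + j)) 0)
  climb> j zero    _       zero    _        = tip<vtx {j} {suc j} 0 ≤-refl
  climb> j zero    _       (suc y) (s≤s ())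
  climb> j (suc d) (_ , _) zero    _        = tip<vtx {j} {suc (suc d + j)} 0 (j<1+d+j (suc d) j)
  climb> j (suc d) (e , J) (suc y) (s≤s y<) =
    subst (λ v → tip j < up y v) (sym (par-joined (suc d + j) e))
      (along (suc d + j) (γ (suc d + j)) (climb j d) (γ≤ℓ (suc d + j))
        (tip<vtx {j} {suc d + j} 0 (j<1+d+j d j)) (climb> j d J) y y<)

  up-climb : ∀ j d → Joined j d → up (climb j d) (vtx (suc (d + j)) 0) ≡ vtx j (γ j)
  up-climb j zero    e       = par-joined j e
  up-climb j (suc d) (e , J) = trans (cong (up (γ (suc d + j) + climb j d)) (par-joined (suc d + j) e))
    (trans (up-vtx (suc d + j) (γ (suc d + j)) (climb j d) (γ≤ℓ (suc d + j))) (up-climb j d J))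

  apart-along : ∀ {j} k → j < k → (∀ y → up y (vtx k 0) ≡ 0 ⊎ tip j < up y (vtx k 0)) →
                ∀ o → o ≤ ℓ k → ∀ y → up y (vtx k o) ≡ 0 ⊎ tip j < up y (vtx k o)
  apart-along k j<k P zero    _   y       = P y
  apart-along {j} k j<k P (suc o) _   zero    = inj₂ (tip<vtx {j} {k} (suc o) j<k)
  apart-along {j} k j<k P (suc o) o<ℓ (suc y) =
    subst (λ v → up y v ≡ 0 ⊎ tip j < up y v) (sym (par-suc k o o<ℓ))
      (apart-along k j<k P o (<⇒≤ o<ℓ) y)

  -- If a fresh segment intervenes, the climb reaches the hub before it gets to segment `j`. The
  -- bound by `tip j` is what rules out a common ancestor, as the ancestors of `tip j` do not exceed
  -- it.
  joined-or-apart : ∀ j d → Joined j d ⊎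
                    (∀ y → up y (vtx (suc (d + j)) 0) ≡ 0 ⊎ tip j < up y (vtx (suc (d + j)) 0))
  joined-or-apart j d with fresh (suc (d + j)) in e
  joined-or-apart j d | true = inj₂ λ where
    zero    → inj₂ (tip<vtx {j} {suc (d + j)} 0 (j<1+d+j d j))
    (suc y) → inj₁ (trans (cong (up y) (par-fresh (d + j) e)) (up-zero y))
  joined-or-apart j zero    | false = inj₁ e
  joined-or-apart j (suc d) | false with joined-or-apart j d
  ... | inj₁ J = inj₁ (e , J)
  ... | inj₂ P = inj₂ λ where
    zero    → inj₂ (tip<vtx {j} {suc (suc d + j)} 0 (j<1+d+j (suc d) j))
    (suc y) → subst (λ v → up y v ≡ 0 ⊎ tip j < up y v) (sym (par-joined (suc d + j) e))
                (apart-along (suc d + j) (j<1+d+j d j) P (γ (suc d + j)) (γ≤ℓ (suc d + j)) y)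

  -- Classification of the cycles

  Valid : Code → Set
  Valid (single k) = k < N
  Valid (pair j d) = suc (d + j) < N × Joined j d

  u⟨_⟩ a⟨_⟩ v⟨_⟩ b⟨_⟩ : Code → ℕ
  u⟨ single k ⟩ = tip k
  u⟨ pair j d ⟩ = tip j
  a⟨ single k ⟩ = ℓ k + rim k
  a⟨ pair j d ⟩ = σ j
  v⟨ single k ⟩ = up (ℓ k + rim k) (tip k)
  v⟨ pair j d ⟩ = tip (suc (d + j))
  b⟨ single k ⟩ = 0
  b⟨ pair j d ⟩ = ℓ (suc (d + j)) + climb j d

  length⟨_⟩ : Code → ℕ
  length⟨ c ⟩ = suc (suc (a⟨ c ⟩ + b⟨ c ⟩))

  up-rim : ∀ k → ∃ λ r → up (rim k) (vtx k 0) ≡ suc r × par (suc r) ≡ 0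
  up-rim zero = 0 , refl , par-zero 0
  up-rim (suc k) with fresh (suc k) in e
  ... | true  = base (suc k) + 0 , refl , par-fresh k e
  ... | false with up-rim k
  ...   | r , p , q = r , trans (cong (up (γ k + rim k)) (par-joined k e))
                              (trans (up-vtx k (γ k) (rim k) (γ≤ℓ k)) p) , q

  -- Past a child of the hub a climb never leaves the hub.
  root-unique : ∀ a b v → par (up a v) ≡ 0 → up b v ≢ 0 → b ≤ a
  root-unique a b v e ≢0 = ≮⇒≥ λ a<b → ≢0
    (trans (cong (λ x → up x v) (sym (m+[n∸m]≡n a<b)))
      (trans (up-+ (suc a) (b ∸ suc a) v)
        (trans (cong (up (b ∸ suc a)) (trans (up-suc a v) e)) (up-zero (b ∸ suc a)))))

  module _ {n} {C : Cycle (graph n)} where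

    Classified : Set
    Classified = ∃ λ c → Valid c × Shape C u⟨ c ⟩ a⟨ c ⟩ v⟨ c ⟩ b⟨ c ⟩

    root-a≡0 : ∀ {u a v b} → Shape C u a v b → par u ≡ 0 → a ≡ 0
    root-a≡0 {a = zero}  S e = refl
    root-a≡0 {a = suc a} S e = contradiction (trans (cong (up a) e) (up-zero a)) (Shape.top≢0 S)

    classify-hub : ∀ {u a v b} → Shape C u a v b → end u ≡ true → par v ≡ 0 → Classified
    classify-hub {u} {a} {v} {b} S eu pv with end⁻ u eu | root-a≡0 (Shape-swap S) pv
    ... | k , k<N , refl | refl = single k , k<N ,
      subst (λ v → Shape C (tip k) (ℓ k + rim k) v 0) (trans (sym meet) (cong (λ x → up x (tip k)) a≡))
        (subst (λ a → Shape C (tip k) a v 0) a≡ S)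
      where
      open Shape S
      a≡ : a ≡ ℓ k + rim k
      a≡ with up-rim k
      ... | r , p , q = ≤-antisym
        (root-unique (ℓ k + rim k) a (tip k) (trans (cong par depth) q) top≢0)
        (root-unique a (ℓ k + rim k) (tip k) (trans (cong par meet) pv) (λ e → 1+n≢0 (trans (sym depth) e)))
        where
        depth : up (ℓ k + rim k) (tip k) ≡ suc r
        depth = trans (up-vtx k (ℓ k) (rim k) ≤-refl) p

    classify-pair : ∀ {a b} j d → suc (d + j) < N → Shape C (tip j) a (tip (suc (d + j))) b → Classified
    classify-pair {a} {b} j d k<N S with joined-or-apart j d
    ... | inj₂ P = contradiction (up-≤ a (tip j)) (impossible (apart-along (suc (d + j)) (j<1+d+j d j) P (ℓ (suc (d + j))) ≤-refl b))
      where
      open Shape S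
      impossible : up b (tip (suc (d + j))) ≡ 0 ⊎ tip j < up b (tip (suc (d + j))) → ¬ up a (tip j) ≤ tip j
      impossible (inj₁ e) _ = top≢0 (trans meet e)
      impossible (inj₂ p) q = <⇒≱ p (subst (_≤ tip j) meet q)
    ... | inj₁ J = pair j d , (k<N , J) , subst₂ (λ a b → Shape C (tip j) a (tip (suc (d + j))) b) a≡ b≡ S
      where
      open Shape S
      v′ Q B : ℕ
      v′ = tip (suc (d + j))
      Q  = vtx j (γ j)
      B  = ℓ (suc (d + j)) + climb j d
      up-B : up B v′ ≡ Q
      up-B = trans (up-vtx (suc (d + j)) (ℓ (suc (d + j))) (climb j d) ≤-refl) (up-climb j d J)
      -- Before step `B` the ancestors of the later tip exceed `tip j`; the top, an ancestor of
      -- `tip j`, does not.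
      B≤b : B ≤ b
      B≤b = ≮⇒≥ λ b<B → <⇒≱
        (along (suc (d + j)) (ℓ (suc (d + j))) (climb j d) ≤-refl
          (tip<vtx {j} {suc (d + j)} 0 (j<1+d+j d j)) (climb> j d J) b b<B)
        (subst (_≤ tip j) meet (up-≤ a (tip j)))
      top-b : up b v′ ≡ up (b ∸ B) Q
      top-b = trans (cong (λ x → up x v′) (sym (m+[n∸m]≡n B≤b)))
                    (trans (up-+ B (b ∸ B) v′) (cong (up (b ∸ B)) up-B))
      -- The spoke vertices of `j` exceed its foot `Q`, whereas the top is an ancestor of `Q`.
      σ≤a : σ j ≤ a
      σ≤a = ≮⇒≥ λ a<σ → <⇒≱ (up-spoke> j (σ j) a ≤-refl a<σ)
        (subst (_≤ Q) (sym (trans meet top-b)) (up-≤ (b ∸ B) Q))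
      top-a : up a (tip j) ≡ up (a ∸ σ j) Q
      top-a = trans (cong (λ x → up x (tip j)) (sym (m+[n∸m]≡n σ≤a)))
                    (trans (up-+ (σ j) (a ∸ σ j) (tip j)) (cong (up (a ∸ σ j)) (up-spoke j (σ j) ≤-refl)))
      excess≡ : a ∸ σ j ≡ b ∸ B
      excess≡ = up-injective (a ∸ σ j) (b ∸ B) Q (trans (sym top-a) (trans meet top-b))
                  (λ e → top≢0 (trans top-a e))
      -- If both climbs continued beyond `Q`, they would share the vertex just below the top,
      -- contrary to `apart`.
      no-excess : ∀ x → a ∸ σ j ≡ x → b ∸ B ≡ x → x ≡ 0
      no-excess zero    _  _  = refl
      no-excess (suc x) ea eb = contradiction
        (trans (up-+ (σ j) x (tip j)) (trans (cong (up x) (trans (up-spoke j (σ j) ≤-refl) (sym up-B))) (sym (up-+ B x v′))))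
        (apart (σ j + x) (B + x)
          (trans (sym (m+[n∸m]≡n σ≤a)) (trans (cong (σ j +_) ea) (+-suc (σ j) x)))
          (trans (sym (m+[n∸m]≡n B≤b)) (trans (cong (B +_) eb) (+-suc B x))))
      excess≡0 : a ∸ σ j ≡ 0
      excess≡0 = no-excess (a ∸ σ j) refl (sym excess≡)
      a≡ : a ≡ σ j
      a≡ = ≤-antisym (m∸n≡0⇒m≤n excess≡0) σ≤a
      b≡ : b ≡ B
      b≡ = ≤-antisym (m∸n≡0⇒m≤n (trans (sym excess≡) excess≡0)) B≤b

    classify-ends : ∀ {a b} j k → j < k → k < N → Shape C (tip j) a (tip k) b → Classified
    classify-ends {a} {b} j k j<k k<N S = classify-pair j d (subst (_< N) (sym k≡) k<N)
        (subst (λ k → Shape C (tip j) a (tip k) b) (sym k≡) S)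
      where
      d = k ∸ suc j
      k≡ : suc (d + j) ≡ k
      k≡ = trans (sym (+-suc d j)) (m∸n+n≡m j<k)

    classify : ∀ {u a v b} → Shape C u a v b → Classified
    classify {u} {a} {v} {b} S with Shape.nearˡ S | Shape.nearʳ S
    ... | inj₁ eu | inj₂ pv = classify-hub S eu pv
    ... | inj₂ pu | inj₁ ev = classify-hub (Shape-swap S) ev pu
    ... | inj₂ pu | inj₂ pv with root-a≡0 S pu | root-a≡0 (Shape-swap S) pv
    ...   | refl | refl = contradiction (Shape.meet S) (Shape.u≢v S)
    classify {u} {a} {v} {b} S | inj₁ eu | inj₁ ev with end⁻ u eu | end⁻ v ev
    ... | j , j<N , refl | k , k<N , refl with <-cmp j k
    ...   | tri< j<k _ _  = classify-ends j k j<k k<N S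
    ...   | tri≈ _ refl _ = contradiction refl (Shape.u≢v S)
    ...   | tri> _ _ k<j  = classify-ends k j k<j j<N (Shape-swap S)

  -- A code fixes the shape and the shape fixes the edges, so cycles need only be compared through
  -- their codes.
  distinct : (∀ c d → Valid c → Valid d → length⟨ c ⟩ ≡ length⟨ d ⟩ → c ≡ d) →
             ∀ n → DistinctCycleLengths (graph n)
  distinct length-injective n C D e = same (classified C) (classified D)
    where
    classified : ∀ C → Classified {C = C}
    classified C = let _ , _ , _ , _ , S = shape C in classify S
    transfer : ∀ {C D : Cycle (graph n)} {u a v b} → Shape C u a v b → Shape D u a v b →
               ∀ y z → CycleEdge C y z → CycleEdge D y z
    transfer S S′ y z e = let p , q , r , s = Shape.edge⇒ S y z e in Shape.edge⇐ S′ y z p q r s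
    same : Classified {C = C} → Classified {C = D} → SameCycle C D
    same (c , vc , S) (d , vd , S′)
      with length-injective c d vc vd (trans (sym (Shape.len≡ S)) (trans e (Shape.len≡ S′)))
    ... | refl = λ y z → transfer S S′ y z , transfer S′ S y z

-- Boolean checks on lists

not-true⁻ : ∀ {b} → not b ≡ true → b ≡ false
not-true⁻ {false} _ = refl

≤ᵇ-true⇒≤ : ∀ {m n} → (m ≤ᵇ n) ≡ true → m ≤ n
≤ᵇ-true⇒≤ {zero}  _ = z≤n
≤ᵇ-true⇒≤ {suc m} e = <ᵇ-true⇒< e

all-true⁻ : ∀ {A : Set} (p : A → Bool) {xs x} → all p xs ≡ true → x ∈ xs → p x ≡ true
all-true⁻ p {x ∷ xs} e (here refl) = proj₁ (∧-true⁻ {p x} e)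
all-true⁻ p {x ∷ xs} e (there i)   = all-true⁻ p (proj₂ (∧-true⁻ {p x} e)) i

any-true⁻ : ∀ {A : Set} (p : A → Bool) xs → any p xs ≡ true → ∃ λ x → p x ≡ true
any-true⁻ p (x ∷ xs) e with ∨-true⁻ {p x} e
... | inj₁ q = x , q
... | inj₂ q = any-true⁻ p xs q

pairwise : ∀ {A : Set} → (A → A → Bool) → List A → Bool
pairwise r []       = true
pairwise r (x ∷ xs) = all (r x) xs ∧ pairwise r xs

pairwise⁻ : ∀ {A : Set} (r : A → A → Bool) {xs x y} → pairwise r xs ≡ true → x ∈ xs → y ∈ xs →
            x ≡ y ⊎ r x y ≡ true ⊎ r y x ≡ true
pairwise⁻ r e (here refl) (here refl) = inj₁ refl
pairwise⁻ r {x ∷ xs} e (here refl) (there j) = inj₂ (inj₁ (all-true⁻ (r x) (proj₁ (∧-true⁻ {all (r x) xs} e)) j))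
pairwise⁻ r {y ∷ xs} e (there i) (here refl) = inj₂ (inj₂ (all-true⁻ (r y) (proj₁ (∧-true⁻ {all (r y) xs} e)) i))
pairwise⁻ r {z ∷ xs} e (there i) (there j) = pairwise⁻ r (proj₂ (∧-true⁻ {all (r z) xs} e)) i j

lookupOr : ∀ {A : Set} → A → List A → ℕ → A
lookupOr d []       _       = d
lookupOr d (x ∷ xs) zero    = x
lookupOr d (x ∷ xs) (suc i) = lookupOr d xs i

lookupOr-all : ∀ {A : Set} (p : A → Bool) d xs i → p d ≡ true → all p xs ≡ true → p (lookupOr d xs i) ≡ true
lookupOr-all p d []       i       pd e = pd
lookupOr-all p d (x ∷ xs) zero    pd e = proj₁ (∧-true⁻ {p x} e)
lookupOr-all p d (x ∷ xs) (suc i) pd e = lookupOr-all p d xs i pd (proj₂ (∧-true⁻ {p x} e))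

-- Polynomials in s

record Linear : Set where
  constructor lin
  field l₀ l₁ : ℕ

record Quadratic : Set where
  constructor quad
  field q₀ q₁ q₂ : ℕ

evalˡ : Linear → ℕ → ℕ
evalˡ (lin a b) s = a + b * s

evalq : Quadratic → ℕ → ℕ
evalq (quad a b c) s = a + b * s + c * (s * s)

infixl 6 _+ˡ_ _+q_
infixl 7 _*ˡ_ _·ˡ_ _·q_

_+ˡ_ : Linear → Linear → Linear
lin a b +ˡ lin c d = lin (a + c) (b + d)

_·ˡ_ : ℕ → Linear → Linear
k ·ˡ lin a b = lin (k * a) (k * b)

_*ˡ_ : Linear → Linear → Quadratic
lin a b *ˡ lin c d = quad (a * c) (a * d + b * c) (b * d)

_+q_ : Quadratic → Quadratic → Quadratic
quad a b c +q quad a′ b′ c′ = quad (a + a′) (b + b′) (c + c′)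

_·q_ : ℕ → Quadratic → Quadratic
k ·q quad a b c = quad (k * a) (k * b) (k * c)

constˡ : ℕ → Linear
constˡ a = lin a 0

toQ : Linear → Quadratic
toQ (lin a b) = quad a b 0

eval-+ˡ : ∀ p q s → evalˡ (p +ˡ q) s ≡ evalˡ p s + evalˡ q s
eval-+ˡ (lin a b) (lin c d) s = h a b c d s
  where h : ∀ a b c d s → a + c + (b + d) * s ≡ a + b * s + (c + d * s)
        h = solve-∀

eval-·ˡ : ∀ k p s → evalˡ (k ·ˡ p) s ≡ k * evalˡ p s
eval-·ˡ k (lin a b) s = h k a b s
  where h : ∀ k a b s → k * a + k * b * s ≡ k * (a + b * s)
        h = solve-∀

eval-*ˡ : ∀ p q s → evalq (p *ˡ q) s ≡ evalˡ p s * evalˡ q s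
eval-*ˡ (lin a b) (lin c d) s = h a b c d s
  where h : ∀ a b c d s → a * c + (a * d + b * c) * s + b * d * (s * s) ≡ (a + b * s) * (c + d * s)
        h = solve-∀

eval-+q : ∀ p q s → evalq (p +q q) s ≡ evalq p s + evalq q s
eval-+q (quad a b c) (quad a′ b′ c′) s = h a b c a′ b′ c′ s
  where h : ∀ a b c a′ b′ c′ s → a + a′ + (b + b′) * s + (c + c′) * (s * s) ≡
                                 a + b * s + c * (s * s) + (a′ + b′ * s + c′ * (s * s))
        h = solve-∀

eval-·q : ∀ k p s → evalq (k ·q p) s ≡ k * evalq p s
eval-·q k (quad a b c) s = h k a b c s
  where h : ∀ k a b c s → k * a + k * b * s + k * c * (s * s) ≡ k * (a + b * s + c * (s * s))
        h = solve-∀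

eval-toQ : ∀ p s → evalq (toQ p) s ≡ evalˡ p s
eval-toQ (lin a b) s = +-identityʳ (a + b * s)

_≤q_ : Quadratic → Quadratic → Bool
quad a b c ≤q quad a′ b′ c′ = (a ≤ᵇ a′) ∧ (b ≤ᵇ b′) ∧ (c ≤ᵇ c′)

eval-≤q : ∀ p q s → p ≤q q ≡ true → evalq p s ≤ evalq q s
eval-≤q (quad a b c) (quad a′ b′ c′) s e with ∧-true⁻ {a ≤ᵇ a′} e
... | e₀ , e′ with ∧-true⁻ {b ≤ᵇ b′} e′
...   | e₁ , e₂ = +-mono-≤ (+-mono-≤ (≤ᵇ-true⇒≤ {a} e₀) (*-monoˡ-≤ s (≤ᵇ-true⇒≤ {b} e₁)))
                           (*-monoˡ-≤ (s * s) (≤ᵇ-true⇒≤ {c} e₂))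

_≡ˡ_ : Linear → Linear → Bool
lin a b ≡ˡ lin c d = (a ≡ᵇ c) ∧ (b ≡ᵇ d)

eval-≡ˡ : ∀ p q s → p ≡ˡ q ≡ true → evalˡ p s ≡ evalˡ q s
eval-≡ˡ (lin a b) (lin c d) s e with ∧-true⁻ {a ≡ᵇ c} e
... | e₀ , e₁ = cong₂ (λ x y → x + y * s) (≡ᵇ-true⇒≡ {a} e₀) (≡ᵇ-true⇒≡ {b} e₁)

-- Linear forms in s and i

record Form : Set where
  constructor form
  field c₀ c₁ c₂ : ℕ

open Form

⟦_⟧ : Form → ℕ → ℕ → ℕ
⟦ form a b c ⟧ s i = a + b * s + c * i

infixr 6 _⊕_

_⊕_ : Form → Form → Form
form a b c ⊕ form a′ b′ c′ = form (a + a′) (b + b′) (c + c′)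

constᶠ : ℕ → Form
constᶠ a = form a 0 0

⟦⊕⟧ : ∀ f g s i → ⟦ f ⊕ g ⟧ s i ≡ ⟦ f ⟧ s i + ⟦ g ⟧ s i
⟦⊕⟧ (form a b c) (form a′ b′ c′) s i = h a b c a′ b′ c′ s i
  where h : ∀ a b c a′ b′ c′ s i → a + a′ + (b + b′) * s + (c + c′) * i ≡
                                   a + b * s + c * i + (a′ + b′ * s + c′ * i)
        h = solve-∀

⟦const⊕⟧ : ∀ k f s i → ⟦ constᶠ k ⊕ f ⟧ s i ≡ k + ⟦ f ⟧ s i
⟦const⊕⟧ k (form a b c) s i = h k a b c s i
  where h : ∀ k a b c s i → k + a + b * s + c * i ≡ k + (a + b * s + c * i)
        h = solve-∀

-- Two families ⟦ f ⟧ s i (i < n) and ⟦ g ⟧ s j (j < n′) with n, n′ linear in s are disjoint if one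
-- lies below the other or if they differ modulo a common divisor of their coefficients.
below : Linear → Form → Form → Bool
below (lin n₀ n₁) f g = (c₀ f + c₂ f * pred n₀ <ᵇ c₀ g) ∧ (c₁ f + c₂ f * n₁ ≤ᵇ c₁ g)

module _ (d : ℕ) where
  periodic : Form → Bool
  periodic f = (c₁ f % suc d ≡ᵇ 0) ∧ (c₂ f % suc d ≡ᵇ 0)

  incongruent : Form → Form → Bool
  incongruent f g = not (c₀ f % suc d ≡ᵇ c₀ g % suc d) ∧ periodic f ∧ periodic g

  ⟦periodic⟧ : ∀ f s i → periodic f ≡ true → ⟦ f ⟧ s i % suc d ≡ c₀ f % suc d
  ⟦periodic⟧ (form a b c) s i e with ∧-true⁻ {b % suc d ≡ᵇ 0} e
  ... | e₁ , e₂ = trans (%-remove-+ʳ (a + b * s) (∣m⇒∣m*n i (m%n≡0⇒n∣m c (suc d) (≡ᵇ-true⇒≡ e₂))))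
                        (%-remove-+ʳ a (∣m⇒∣m*n s (m%n≡0⇒n∣m b (suc d) (≡ᵇ-true⇒≡ e₁))))

-- The moduli `suc d` run from 1 to 12. All of them divide 27720, so the multiples of t in a length
-- do not hinder `periodic`.
separated : Linear → Form → Linear → Form → Bool
separated n f n′ g = below n f g ∨ below n′ g f ∨ any (λ d → incongruent d f g) (upTo 12)

-- The extreme case is the last index for `f` and index 0 for `g`. Positivity of the constant term
-- of `n` makes `pred n₀` the constant term of the last index.
below⁻ : ∀ n f g s i j → below n f g ≡ true → 1 ≤ Linear.l₀ n → i < evalˡ n s → ⟦ f ⟧ s i < ⟦ g ⟧ s j
below⁻ (lin (suc n₀) n₁) (form a b c) (form a′ b′ c′) s i j e _ (s≤s i<) with ∧-true⁻ {a + c * n₀ <ᵇ a′} e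
... | e₀ , e₁ = begin-strict
  a + b * s + c * i                     ≤⟨ +-monoʳ-≤ (a + b * s) (*-monoʳ-≤ c i<) ⟩
  a + b * s + c * (n₀ + n₁ * s)         ≡⟨ h a b c n₀ n₁ s ⟩
  (a + c * n₀) + (b + c * n₁) * s       <⟨ +-mono-<-≤ (<ᵇ-true⇒< e₀) (*-monoˡ-≤ s (≤ᵇ-true⇒≤ {b + c * n₁} e₁)) ⟩
  a′ + b′ * s                           ≤⟨ m≤m+n _ _ ⟩
  a′ + b′ * s + c′ * j                  ∎
  where
  open ≤-Reasoning
  h : ∀ a b c n₀ n₁ s → a + b * s + c * (n₀ + n₁ * s) ≡ (a + c * n₀) + (b + c * n₁) * s
  h = solve-∀

separated⁻ : ∀ n f n′ g s i j → separated n f n′ g ≡ true → 1 ≤ Linear.l₀ n → 1 ≤ Linear.l₀ n′ →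
             i < evalˡ n s → j < evalˡ n′ s → ⟦ f ⟧ s i ≢ ⟦ g ⟧ s j
separated⁻ n f n′ g s i j e 1≤n 1≤n′ i< j< eq with ∨-true⁻ {below n f g} e
... | inj₁ p = <⇒≢ (below⁻ n f g s i j p 1≤n i<) eq
... | inj₂ q with ∨-true⁻ {below n′ g f} q
...   | inj₁ p = <⇒≢ (below⁻ n′ g f s j i p 1≤n′ j<) (sym eq)
...   | inj₂ r with any-true⁻ (λ d → incongruent d f g) (upTo 12) r
...     | d , p with ∧-true⁻ {not (c₀ f % suc d ≡ᵇ c₀ g % suc d)} p
...       | p₀ , p′ with ∧-true⁻ {periodic d f} p′
...         | p₁ , p₂ with () ← trans (sym (not-true⁻ p₀)) (trans (cong (_≡ᵇ c₀ g % suc d)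
                (trans (sym (⟦periodic⟧ d f s i p₁)) (trans (cong (_% suc d) eq) (⟦periodic⟧ d g s j p₂))))
                (≡ᵇ-refl (c₀ g % suc d)))

-- A mode describes `count` blocks, one for each i < count; a block consists of consecutive segments,
-- only the first of which is fresh, with the forms of γ and σ listed.
record Mode : Set where
  constructor mode
  field
    count    : Linear
    segments : List (Form × Form)

open Mode

pendant : Form × Form
pendant = constᶠ 0 , constᶠ 0

-- A list of modes is continued by blocks of one vertex, which absorb the surplus of vertices.
pendants : Mode
pendants = mode (constˡ 1) (pendant ∷ [])

wellFormed : Mode → Bool
wellFormed m = (1 ≤ᵇ Linear.l₀ (count m)) ∧ (1 ≤ᵇ length (segments m))

segmentAt : List (Form × Form) → ℕ → Form × Form
segmentAt = lookupOr pendant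

module _ (l : List (Form × Form)) where

  γᶠ σᶠ ℓᶠ rimᶠ : ℕ → Form
  γᶠ x = proj₁ (segmentAt l x)
  σᶠ x = proj₂ (segmentAt l x)
  ℓᶠ x = γᶠ x ⊕ σᶠ x
  rimᶠ zero    = constᶠ 0
  rimᶠ (suc x) = constᶠ 1 ⊕ γᶠ x ⊕ rimᶠ x

  climbᶠ : ℕ → ℕ → Form
  climbᶠ x zero    = constᶠ 1
  climbᶠ x (suc d) = constᶠ 1 ⊕ γᶠ (suc d + x) ⊕ climbᶠ x d

  lengthᶠ : Code → Form
  lengthᶠ (single x) = constᶠ 2 ⊕ ℓᶠ x ⊕ rimᶠ x
  lengthᶠ (pair x d) = constᶠ 2 ⊕ σᶠ x ⊕ ℓᶠ (suc (d + x)) ⊕ climbᶠ x d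

-- Families of cycle lengths

codes : ℕ → List Code
codes w = map single (upTo w) ++ concatMap (λ x → map (pair x) (upTo (w ∸ suc x))) (upTo w)

single∈codes : ∀ {w x} → x < w → single x ∈ codes w
single∈codes x<w = ∈-++⁺ˡ (∈-map⁺ single (∈-upTo⁺ x<w))

pair∈codes : ∀ {w} x d → suc (d + x) < w → pair x d ∈ codes w
pair∈codes {w} x d lt = ∈-++⁺ʳ (map single (upTo w)) (∈-concatMap⁺ _
  (Any.map (λ { refl → ∈-map⁺ (pair x) (∈-upTo⁺ d<) }) (∈-upTo⁺ (≤-<-trans (m≤n+m x (suc d)) lt))))
  where
  d< : d < w ∸ suc x
  d< = m+n≤o⇒m≤o∸n (suc d) (subst (λ y → suc y ≤ w) (sym (+-suc d x)) lt)

-- `index` and `code` serve as labels: equality of two families gives back the mode and the position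
-- of the cycle in its block.
record Family : Set where
  constructor family
  field
    index  : ℕ
    code   : Code
    size   : Linear
    value  : Form

open Family

separatedᶠ : Family → Family → Bool
separatedᶠ f g = separated (size f) (value f) (size g) (value g)

modeAt : List Mode → ℕ → Mode
modeAt = lookupOr pendants

familiesOf : ℕ → Mode → List Family
familiesOf k m = map (λ c → family k c (count m) (lengthᶠ (segments m) c)) (codes (length (segments m)))

families : List Mode → List Family
families ms = concatMap (λ k → familiesOf k (modeAt ms k)) (upTo (length ms))

-- Tells apart the corresponding cycles of different blocks of one mode.
increasing : Family → Bool
increasing f = 1 ≤ᵇ Form.c₂ (value f)

family-values-injective :
  ∀ {fs f g s i j} → pairwise separatedᶠ fs ≡ true → all increasing fs ≡ true → f ∈ fs → g ∈ fs →
  1 ≤ Linear.l₀ (size f) → 1 ≤ Linear.l₀ (size g) → i < evalˡ (size f) s → j < evalˡ (size g) s →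
  ⟦ value f ⟧ s i ≡ ⟦ value g ⟧ s j → f ≡ g × i ≡ j
family-values-injective {fs} {f} {g} {s} {i} {j} sep inc f∈ g∈ 1≤f 1≤g i< j< e
  with pairwise⁻ separatedᶠ {fs} sep f∈ g∈
... | inj₁ refl     = refl , cancel (value f) (all-true⁻ increasing inc f∈) e
  where
  cancel : ∀ h → (1 ≤ᵇ Form.c₂ h) ≡ true → ⟦ h ⟧ s i ≡ ⟦ h ⟧ s j → i ≡ j
  cancel (form a b (suc c)) _ e = *-cancelˡ-≡ i j (suc c) (+-cancelˡ-≡ (a + b * s) _ _ e)
... | inj₂ (inj₁ p) = contradiction e (separated⁻ (size f) (value f) (size g) (value g) s i j p 1≤f 1≤g i< j<)
... | inj₂ (inj₂ p) = contradiction (sym e) (separated⁻ (size g) (value g) (size f) (value f) s j i p 1≤g 1≤f j< i<)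

-- The constant coefficient bounds a form from below for all s and i; this supplies `ℓ≥1`.
nondegenerate : Mode → Bool
nondegenerate m = all (λ (g , h) → 1 ≤ᵇ c₀ (g ⊕ h)) (segments m)

-- Counting segments and vertices

segmentTotal : List (Form × Form) → Form
segmentTotal []            = constᶠ 0
segmentTotal ((g , h) ∷ l) = (constᶠ 1 ⊕ g ⊕ h) ⊕ segmentTotal l

-- Twice the number of vertices: 2 ∑ (a + b i) over i < n is n (2 a + b (n ∸ 1)).
modeTotal : Mode → Quadratic
modeTotal (mode (lin n₀ n₁) l) = lin n₀ n₁ *ˡ (2 ·ˡ lin a b +ˡ c ·ˡ lin (pred n₀) n₁)
  where
  a = Form.c₀ (segmentTotal l)
  b = Form.c₁ (segmentTotal l)
  c = Form.c₂ (segmentTotal l)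

total : List Mode → Quadratic
total []       = quad 0 0 0
total (m ∷ ms) = modeTotal m +q total ms

segmentCount : List Mode → Linear
segmentCount []       = constˡ 0
segmentCount (m ∷ ms) = length (segments m) ·ˡ count m +ˡ segmentCount ms

∑-arithmetic : ∀ n f s → 2 * ∑ (suc n) (⟦ f ⟧ s) ≡
               suc n * (2 * (Form.c₀ f + Form.c₁ f * s) + Form.c₂ f * n)
∑-arithmetic zero (form a b c) s = h a b c s
  where h : ∀ a b c s → 2 * (a + b * s + c * 0 + 0) ≡ 1 * (2 * (a + b * s) + c * 0)
        h = solve-∀
∑-arithmetic (suc n) f@(form a b c) s = begin
  2 * ∑ (2 + n) (⟦ f ⟧ s)                              ≡⟨ cong (2 *_) (∑-last (suc n) (⟦ f ⟧ s)) ⟩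
  2 * (∑ (suc n) (⟦ f ⟧ s) + ⟦ f ⟧ s (suc n))          ≡⟨ *-distribˡ-+ 2 (∑ (suc n) (⟦ f ⟧ s)) _ ⟩
  2 * ∑ (suc n) (⟦ f ⟧ s) + 2 * ⟦ f ⟧ s (suc n)        ≡⟨ cong (_+ 2 * ⟦ f ⟧ s (suc n)) (∑-arithmetic n f s) ⟩
  suc n * (2 * (a + b * s) + c * n) + 2 * (a + b * s + c * suc n) ≡⟨ h a b c s n ⟩
  suc (suc n) * (2 * (a + b * s) + c * suc n)          ∎
  where
  open ≡-Reasoning
  h : ∀ a b c s n → suc n * (2 * (a + b * s) + c * n) + 2 * (a + b * s + c * suc n) ≡
                    suc (suc n) * (2 * (a + b * s) + c * suc n)
  h = solve-∀

∑-const : ∀ n c → ∑ n (λ _ → c) ≡ n * c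
∑-const zero    c = refl
∑-const (suc n) c = cong (c +_) (∑-const n c)

segmentSize : List (Form × Form) → ℕ → ℕ → ℕ → ℕ
segmentSize l s i x = suc (⟦ γᶠ l x ⟧ s i + ⟦ σᶠ l x ⟧ s i)

modeSum : (Mode → ℕ → ℕ → ℕ) → ℕ → Mode → ℕ
modeSum f s m = ∑ (evalˡ (count m) s) (λ i → ∑ (length (segments m)) (f m i))

modeSize modeLength : ℕ → Mode → ℕ
modeSize s   = modeSum (λ m i → segmentSize (segments m) s i) s
modeLength s = modeSum (λ _ _ _ → 1) s

blockSize : ∀ l s i → ∑ (length l) (segmentSize l s i) ≡ ⟦ segmentTotal l ⟧ s i
blockSize []            s i = refl
blockSize ((g , h) ∷ l) s i = sym (trans (⟦⊕⟧ (constᶠ 1 ⊕ g ⊕ h) (segmentTotal l) s i)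
  (cong₂ _+_ (trans (⟦const⊕⟧ 1 (g ⊕ h) s i) (cong suc (⟦⊕⟧ g h s i))) (sym (blockSize l s i))))

modeTotal-eval : ∀ m s → wellFormed m ≡ true → 2 * modeSize s m ≡ evalq (modeTotal m) s
modeTotal-eval (mode n@(lin (suc n₀) n₁) l) s _ = begin
  2 * modeSize s (mode n l)
    ≡⟨ cong (2 *_) (∑-cong (suc (n₀ + n₁ * s)) (λ i _ → blockSize l s i)) ⟩
  2 * ∑ (suc (n₀ + n₁ * s)) (⟦ t ⟧ s)
    ≡⟨ ∑-arithmetic (n₀ + n₁ * s) t s ⟩
  evalˡ n s * (2 * evalˡ (lin a b) s + c * evalˡ (lin n₀ n₁) s)
    ≡⟨ cong (evalˡ n s *_) (sym (trans (eval-+ˡ (2 ·ˡ lin a b) (c ·ˡ lin n₀ n₁) s)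
         (cong₂ _+_ (eval-·ˡ 2 (lin a b) s) (eval-·ˡ c (lin n₀ n₁) s)))) ⟩
  evalˡ n s * evalˡ (2 ·ˡ lin a b +ˡ c ·ˡ lin n₀ n₁) s
    ≡⟨ sym (eval-*ˡ n (2 ·ˡ lin a b +ˡ c ·ˡ lin n₀ n₁) s) ⟩
  evalq (n *ˡ (2 ·ˡ lin a b +ˡ c ·ˡ lin n₀ n₁)) s ∎
  where
  open ≡-Reasoning
  t = segmentTotal l
  a = Form.c₀ t
  b = Form.c₁ t
  c = Form.c₂ t

total-eval : ∀ ms s → all wellFormed ms ≡ true →
             2 * ∑ (length ms) (λ k → modeSize s (modeAt ms k)) ≡ evalq (total ms) s
total-eval []       s _ = refl
total-eval (m ∷ ms) s e = trans (*-distribˡ-+ 2 (modeSize s m) (∑ (length ms) (λ k → modeSize s (modeAt ms k))))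
  (trans (cong₂ _+_ (modeTotal-eval m s (proj₁ (∧-true⁻ {wellFormed m} e)))
                    (total-eval ms s (proj₂ (∧-true⁻ {wellFormed m} e))))
         (sym (eval-+q (modeTotal m) (total ms) s)))

segmentCount-eval : ∀ ms s → ∑ (length ms) (λ k → modeLength s (modeAt ms k)) ≡ evalˡ (segmentCount ms) s
segmentCount-eval []       s = refl
segmentCount-eval (m ∷ ms) s = sym (trans (eval-+ˡ (length (segments m) ·ˡ count m) (segmentCount ms) s)
  (cong₂ _+_
    (trans (eval-·ˡ (length (segments m)) (count m) s)
      (trans (*-comm (length (segments m)) (evalˡ (count m) s))
        (sym (trans (∑-const (evalˡ (count m) s) _)
                    (cong (evalˡ (count m) s *_) (∑-one (length (segments m))))))))
    (sym (segmentCount-eval ms s))))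

∑-mono : ∀ {m n} f → m ≤ n → ∑ m f ≤ ∑ n f
∑-mono f z≤n     = z≤n
∑-mono f (s≤s p) = +-monoʳ-≤ (f 0) (∑-mono (f ∘ suc) p)

∑-mono-last : ∀ {m n} f → m < n → ∑ m f + f m ≤ ∑ n f
∑-mono-last {m} f m<n = ≤-trans (≤-reflexive (sym (∑-last m f))) (∑-mono f m<n)

-- The sequence of segments given by a list of modes

module Layout (ms : List Mode) (s : ℕ)
              (wf : all wellFormed ms ≡ true) (nd : all nondegenerate ms ≡ true) where

  segs : ℕ → List (Form × Form)
  segs m = segments (modeAt ms m)

  counts widths : ℕ → ℕ
  counts m = evalˡ (count (modeAt ms m)) s
  widths m = length (segs m)

  -- The mode, the block within the mode, and the segment within the block.
  Loc : Set
  Loc = ℕ × ℕ × ℕ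

  step : Loc → Loc
  step (m , i , x) =
    if suc x <ᵇ widths m then (m , i , suc x)
    else if suc i <ᵇ counts m then (m , suc i , 0)
    else (suc m , 0 , 0)

  data Step (m i x : ℕ) : Loc → Set where
    segment : suc x < widths m → Step m i x (m , i , suc x)
    block   : suc x ≡ widths m → suc i < counts m → Step m i x (m , suc i , 0)
    newMode : suc x ≡ widths m → suc i ≡ counts m → Step m i x (suc m , 0 , 0)

  InRange : Loc → Set
  InRange (m , i , x) = i < counts m × x < widths m

  step-view : ∀ m i x → InRange (m , i , x) → Step m i x (step (m , i , x))
  step-view m i x (i< , x<) with suc x <? widths m
  ... | yes p rewrite <⇒<ᵇ-true p = segment p
  ... | no ¬p rewrite ≮⇒<ᵇ-false ¬p with suc i <? counts m
  ...   | yes q rewrite <⇒<ᵇ-true q = block (≤-antisym x< (≮⇒≥ ¬p)) q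
  ...   | no ¬q rewrite ≮⇒<ᵇ-false ¬q = newMode (≤-antisym x< (≮⇒≥ ¬p)) (≤-antisym i< (≮⇒≥ ¬q))

  wf-at : ∀ m → wellFormed (modeAt ms m) ≡ true
  wf-at m = lookupOr-all wellFormed pendants ms m refl wf

  1≤l₀ : ∀ m → 1 ≤ Linear.l₀ (count (modeAt ms m))
  1≤l₀ m = ≤ᵇ-true⇒≤ (proj₁ (∧-true⁻ {1 ≤ᵇ Linear.l₀ (count (modeAt ms m))} (wf-at m)))

  0<counts : ∀ m → 0 < counts m
  0<counts m = ≤-trans (1≤l₀ m) (m≤m+n _ _)

  0<widths : ∀ m → 0 < widths m
  0<widths m = ≤ᵇ-true⇒≤ (proj₂ (∧-true⁻ {1 ≤ᵇ Linear.l₀ (count (modeAt ms m))} (wf-at m)))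

  inRange-step : ∀ c → InRange c → InRange (step c)
  inRange-step (m , i , x) r@(i< , x<) with step (m , i , x) | step-view m i x r
  ... | _ | segment p   = i< , p
  ... | _ | block p q   = q , 0<widths m
  ... | _ | newMode p q = 0<counts (suc m) , 0<widths (suc m)

  loc : ℕ → Loc
  loc zero    = 0 , 0 , 0
  loc (suc k) = step (loc k)

  inRange : ∀ k → InRange (loc k)
  inRange zero    = 0<counts 0 , 0<widths 0
  inRange (suc k) = inRange-step (loc k) (inRange k)

  -- Weight 1 recovers the number of a segment from its location; the sizes of the segments as
  -- weights give `base`.
  module Weight (V : ℕ → ℕ → ℕ → ℕ) where

    W : ℕ → ℕ → ℕ
    W m i = ∑ (widths m) (V m i)

    before : Loc → ℕ
    before (m , i , x) = ∑ m (λ m → ∑ (counts m) (W m)) + (∑ i (W m) + ∑ x (V m i))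

    before-step : ∀ m i x → InRange (m , i , x) →
                  before (step (m , i , x)) ≡ before (m , i , x) + V m i x
    before-step m i x r with step (m , i , x) | step-view m i x r
    ... | _ | segment p = begin
      A₀ + (∑ i (W m) + ∑ (suc x) (V m i))     ≡⟨ cong (λ y → A₀ + (∑ i (W m) + y)) (∑-last x (V m i)) ⟩
      A₀ + (∑ i (W m) + (∑ x (V m i) + V m i x)) ≡⟨ h A₀ (∑ i (W m)) (∑ x (V m i)) (V m i x) ⟩
      A₀ + (∑ i (W m) + ∑ x (V m i)) + V m i x ∎
      where
      open ≡-Reasoning
      A₀ = ∑ m (λ m → ∑ (counts m) (W m))
      h : ∀ a b c d → a + (b + (c + d)) ≡ a + (b + c) + d
      h = solve-∀
    ... | _ | block p _ = begin
      A₀ + (∑ (suc i) (W m) + 0)               ≡⟨ cong (λ y → A₀ + (y + 0)) (∑-last i (W m)) ⟩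
      A₀ + (∑ i (W m) + W m i + 0)             ≡⟨ cong (λ w → A₀ + (∑ i (W m) + ∑ w (V m i) + 0)) (sym p) ⟩
      A₀ + (∑ i (W m) + ∑ (suc x) (V m i) + 0) ≡⟨ cong (λ y → A₀ + (∑ i (W m) + y + 0)) (∑-last x (V m i)) ⟩
      A₀ + (∑ i (W m) + (∑ x (V m i) + V m i x) + 0) ≡⟨ h A₀ (∑ i (W m)) (∑ x (V m i)) (V m i x) ⟩
      A₀ + (∑ i (W m) + ∑ x (V m i)) + V m i x ∎
      where
      open ≡-Reasoning
      A₀ = ∑ m (λ m → ∑ (counts m) (W m))
      h : ∀ a b c d → a + (b + (c + d) + 0) ≡ a + (b + c) + d
      h = solve-∀
    ... | _ | newMode p q = begin
      ∑ (suc m) (λ m → ∑ (counts m) (W m)) + 0 ≡⟨ cong (_+ 0) (∑-last m (λ m → ∑ (counts m) (W m))) ⟩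
      A₀ + ∑ (counts m) (W m) + 0              ≡⟨ cong (λ c → A₀ + ∑ c (W m) + 0) (sym q) ⟩
      A₀ + ∑ (suc i) (W m) + 0                 ≡⟨ cong (λ y → A₀ + y + 0) (∑-last i (W m)) ⟩
      A₀ + (∑ i (W m) + W m i) + 0             ≡⟨ cong (λ w → A₀ + (∑ i (W m) + ∑ w (V m i)) + 0) (sym p) ⟩
      A₀ + (∑ i (W m) + ∑ (suc x) (V m i)) + 0 ≡⟨ cong (λ y → A₀ + (∑ i (W m) + y) + 0) (∑-last x (V m i)) ⟩
      A₀ + (∑ i (W m) + (∑ x (V m i) + V m i x)) + 0 ≡⟨ h A₀ (∑ i (W m)) (∑ x (V m i)) (V m i x) ⟩
      A₀ + (∑ i (W m) + ∑ x (V m i)) + V m i x ∎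
      where
      open ≡-Reasoning
      A₀ = ∑ m (λ m → ∑ (counts m) (W m))
      h : ∀ a b c d → a + (b + (c + d)) + 0 ≡ a + (b + c) + d
      h = solve-∀

    before-≤ : ∀ m i x M → InRange (m , i , x) → m < M →
               before (m , i , x) + V m i x ≤ ∑ M (λ m → ∑ (counts m) (W m))
    before-≤ m i x M (i< , x<) m<M = begin
      A₀ + (∑ i (W m) + ∑ x (V m i)) + V m i x ≡⟨ h A₀ (∑ i (W m)) (∑ x (V m i)) (V m i x) ⟩
      A₀ + (∑ i (W m) + (∑ x (V m i) + V m i x)) ≤⟨ +-monoʳ-≤ A₀ (+-monoʳ-≤ (∑ i (W m)) (∑-mono-last (V m i) x<)) ⟩
      A₀ + (∑ i (W m) + W m i)                 ≤⟨ +-monoʳ-≤ A₀ (∑-mono-last (W m) i<) ⟩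
      A₀ + ∑ (counts m) (W m)                  ≤⟨ ∑-mono-last (λ m → ∑ (counts m) (W m)) m<M ⟩
      ∑ M (λ m → ∑ (counts m) (W m))           ∎
      where
      open ≤-Reasoning
      A₀ = ∑ m (λ m → ∑ (counts m) (W m))
      h : ∀ a b c d → a + (b + c) + d ≡ a + (b + (c + d))
      h = solve-∀

  module Index = Weight (λ _ _ _ → 1)

  index-loc : ∀ k → Index.before (loc k) ≡ k
  index-loc zero    = refl
  index-loc (suc k) = trans (Index.before-step _ _ _ (inRange k))
    (trans (cong (_+ 1) (index-loc k)) (+-comm k 1))

  loc-injective : ∀ j k → loc j ≡ loc k → j ≡ k
  loc-injective j k e = trans (sym (index-loc j)) (trans (cong Index.before e) (index-loc k))

  N : ℕ
  N = ∑ (length ms) (λ m → ∑ (counts m) (Index.W m))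

  mode< : ∀ k → k < N → proj₁ (loc k) < length ms
  mode< k k<N = ≰⇒> λ M≤m → <⇒≱ k<N (≤-trans
    (∑-mono (λ m → ∑ (counts m) (Index.W m)) M≤m) (≤-trans (m≤m+n _ _) (≤-reflexive (index-loc k))))

  γ σ : ℕ → ℕ
  γ k = let m , i , x = loc k in ⟦ γᶠ (segs m) x ⟧ s i
  σ k = let m , i , x = loc k in ⟦ σᶠ (segs m) x ⟧ s i

  fresh : ℕ → Bool
  fresh k = let m , i , x = loc k in x ≡ᵇ 0

  nd-at : ∀ (l : List (Form × Form)) x → x < length l → all (λ (g , h) → 1 ≤ᵇ Form.c₀ (g ⊕ h)) l ≡ true →
          1 ≤ Form.c₀ (ℓᶠ l x)
  nd-at ((g , h) ∷ l) zero    _        e = ≤ᵇ-true⇒≤ (proj₁ (∧-true⁻ {1 ≤ᵇ Form.c₀ (g ⊕ h)} e))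
  nd-at ((g , h) ∷ l) (suc x) (s≤s x<) e = nd-at l x x< (proj₂ (∧-true⁻ {1 ≤ᵇ Form.c₀ (g ⊕ h)} e))

  nd-mode : ∀ (l : List Mode) m → m < length l → all nondegenerate l ≡ true → nondegenerate (modeAt l m) ≡ true
  nd-mode (m ∷ l) zero    _        e = proj₁ (∧-true⁻ {nondegenerate m} e)
  nd-mode (m ∷ l) (suc k) (s≤s k<) e = nd-mode l k k< (proj₂ (∧-true⁻ {nondegenerate m} e))

  ℓ≥1 : ∀ k → k < N → 1 ≤ γ k + σ k
  ℓ≥1 k k<N = let m , i , x = loc k in
    subst (1 ≤_) (⟦⊕⟧ (γᶠ (segs m) x) (σᶠ (segs m) x) s i)
      (≤-trans (nd-at (segs m) x (proj₂ (inRange k)) (nd-mode ms m (mode< k k<N) nd))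
        (≤-trans (m≤m+n _ _) (m≤m+n _ _)))

  open Tree γ σ fresh N ℓ≥1 using (base; ℓ; numEdges-graph; graph) public
  open Cycles γ σ fresh N ℓ≥1 hiding (u⟨_⟩; v⟨_⟩) public

  V : ℕ → ℕ → ℕ → ℕ
  V m i x = suc (⟦ γᶠ (segs m) x ⟧ s i + ⟦ σᶠ (segs m) x ⟧ s i)

  module Size = Weight V

  base-before : ∀ k → base k ≡ Size.before (loc k)
  base-before zero    = refl
  base-before (suc k) = trans (sym (+-suc (base k) (ℓ k)))
    (trans (cong (_+ suc (ℓ k)) (base-before k)) (sym (Size.before-step _ _ _ (inRange k))))

  vertices : ℕ
  vertices = ∑ (length ms) (λ m → ∑ (counts m) (Size.W m))

  base-N : base N ≤ vertices
  base-N = go N ≤-refl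
    where
    go : ∀ k → k ≤ N → base k ≤ vertices
    go zero    _   = z≤n
    go (suc k) k<N = ≤-trans
      (≤-reflexive (trans (base-before (suc k)) (Size.before-step _ _ _ (inRange k))))
      (Size.before-≤ _ _ _ (length ms) (inRange k) (mode< k k<N))

  -- Lengths of cycles

  loc-suc : ∀ k {m i x} → loc k ≡ (m , i , x) → fresh (suc k) ≡ false → loc (suc k) ≡ (m , i , suc x)
  loc-suc k {m} {i} {x} refl e with step (m , i , x) | step-view m i x (inRange k)
  ... | _ | segment _   = refl

  loc-pred : ∀ k {m i x} → loc (suc k) ≡ (m , i , suc x) → loc k ≡ (m , i , x)
  loc-pred k = go (loc k) (inRange k)
    where
    go : ∀ c → InRange c → ∀ {m i x} → step c ≡ (m , i , suc x) → c ≡ (m , i , x)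
    go (m , i , x) r e with step (m , i , x) | step-view m i x r
    go (m , i , x) r refl | _ | segment _ = refl

  fresh-loc : ∀ k {m i x} → loc k ≡ (m , i , x) → fresh k ≡ (x ≡ᵇ 0)
  fresh-loc k refl = refl

  γ-loc : ∀ k {m i x} → loc k ≡ (m , i , x) → γ k ≡ ⟦ γᶠ (segs m) x ⟧ s i
  γ-loc k refl = refl

  σ-loc : ∀ k {m i x} → loc k ≡ (m , i , x) → σ k ≡ ⟦ σᶠ (segs m) x ⟧ s i
  σ-loc k refl = refl

  ℓ-loc : ∀ k {m i x} → loc k ≡ (m , i , x) → ℓ k ≡ ⟦ ℓᶠ (segs m) x ⟧ s i
  ℓ-loc k {m} {i} {x} refl = sym (⟦⊕⟧ (γᶠ (segs m) x) (σᶠ (segs m) x) s i)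

  ⟦1+γ⊕⟧ : ∀ k m i x f y → loc k ≡ (m , i , x) → y ≡ ⟦ f ⟧ s i →
           suc (γ k + y) ≡ ⟦ constᶠ 1 ⊕ γᶠ (segs m) x ⊕ f ⟧ s i
  ⟦1+γ⊕⟧ k m i x f y e y≡ = sym (trans (⟦const⊕⟧ 1 (γᶠ (segs m) x ⊕ f) s i)
    (cong suc (trans (⟦⊕⟧ (γᶠ (segs m) x) f s i) (cong₂ _+_ (sym (γ-loc k e)) (sym y≡)))))

  rim-loc : ∀ k {m i} x → loc k ≡ (m , i , x) → rim k ≡ ⟦ rimᶠ (segs m) x ⟧ s i
  rim-loc zero    zero refl = refl
  rim-loc (suc k) zero e = rim-fresh k (fresh-loc (suc k) e)
  rim-loc (suc k) {m} {i} (suc x) e = trans (rim-joined k (fresh-loc (suc k) e))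
    (⟦1+γ⊕⟧ k m i x (rimᶠ (segs m) x) (rim k) (loc-pred k e) (rim-loc k x (loc-pred k e)))

  joined-loc : ∀ j d {m i x} → Joined j d → loc j ≡ (m , i , x) → loc (suc (d + j)) ≡ (m , i , suc (d + x))
  joined-loc j zero    e       eq = loc-suc j eq e
  joined-loc j (suc d) (e , J) eq = loc-suc (suc (d + j)) (joined-loc j d J eq) e

  climb-loc : ∀ j d {m i x} → Joined j d → loc j ≡ (m , i , x) → climb j d ≡ ⟦ climbᶠ (segs m) x d ⟧ s i
  climb-loc j zero    J       eq = refl
  climb-loc j (suc d) {m} {i} {x} (e , J) eq =
    ⟦1+γ⊕⟧ (suc d + j) m i (suc d + x) (climbᶠ (segs m) x d) (climb j d)
      (joined-loc j d J eq) (climb-loc j d J eq)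

  place : Code → ℕ × ℕ × Code
  place (single k) = let m , i , x = loc k in m , i , single x
  place (pair j d) = let m , i , x = loc j in m , i , pair x d

  length-place : ∀ c → Valid c → let m , i , c′ = place c in length⟨ c ⟩ ≡ ⟦ lengthᶠ (segs m) c′ ⟧ s i
  length-place (single k) v = let m , i , x = loc k in
    sym (trans (⟦const⊕⟧ 2 (ℓᶠ (segs m) x ⊕ rimᶠ (segs m) x) s i)
      (cong (2 +_) (trans (⟦⊕⟧ (ℓᶠ (segs m) x) (rimᶠ (segs m) x) s i)
        (trans (cong₂ _+_ (sym (ℓ-loc k refl)) (sym (rim-loc k x refl))) (sym (+-identityʳ _))))))
  length-place (pair j d) (_ , J) = let m , i , x = loc j in
    sym (trans (⟦const⊕⟧ 2 (σᶠ (segs m) x ⊕ ℓᶠ (segs m) (suc (d + x)) ⊕ climbᶠ (segs m) x d) s i)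
      (cong (2 +_) (trans (⟦⊕⟧ (σᶠ (segs m) x) (ℓᶠ (segs m) (suc (d + x)) ⊕ climbᶠ (segs m) x d) s i)
        (cong₂ _+_ (sym (σ-loc j refl))
          (trans (⟦⊕⟧ (ℓᶠ (segs m) (suc (d + x))) (climbᶠ (segs m) x d) s i)
            (cong₂ _+_ (sym (ℓ-loc (suc (d + j)) (joined-loc j d J refl))) (sym (climb-loc j d J refl))))))))

  familyAt : ℕ → Code → Family
  familyAt m c = family m c (count (modeAt ms m)) (lengthᶠ (segs m) c)

  family∈ : ∀ m c → m < length ms → c ∈ codes (widths m) → familyAt m c ∈ families ms
  family∈ m c m< c∈ = ∈-concatMap⁺ (λ k → familiesOf k (modeAt ms k))
    (Any.map (λ { refl → ∈-map⁺ (λ c → familyAt m c) c∈ }) (∈-upTo⁺ m<))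

  valid⇒family : ∀ c → Valid c → let m , i , c′ = place c in familyAt m c′ ∈ families ms × i < counts m
  valid⇒family (single k) k<N = let m , i , x = loc k ; i< , x< = inRange k in
    family∈ m (single x) (mode< k k<N) (single∈codes x<) , i<
  valid⇒family (pair j d) (k<N , J) = let m , i , x = loc j in
    family∈ m (pair x d) (mode< j (<-trans (j<1+d+j d j) k<N))
      (pair∈codes x d (proj₂ (subst InRange (joined-loc j d J refl) (inRange (suc (d + j)))))) ,
    proj₁ (inRange j)

  place-injective : ∀ c c′ → place c ≡ place c′ → c ≡ c′
  place-injective (single j) (single k) e = cong single (loc-injective j k (location e))
    where
    location : ∀ {m i x m′ i′ x′} → (m , i , single x) ≡ (m′ , i′ , single x′) → (m , i , x) ≡ (m′ , i′ , x′)
    location refl = refl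
  place-injective (pair j d) (pair k d′) e with loc-injective j k (proj₁ (components e)) | proj₂ (components e)
    where
    components : ∀ {m i x d m′ i′ x′ d′} → (m , i , pair x d) ≡ (m′ , i′ , pair x′ d′) →
                 (m , i , x) ≡ (m′ , i′ , x′) × d ≡ d′
    components refl = refl , refl
  ... | refl | refl = refl
  place-injective (single j) (pair k d) ()
  place-injective (pair j d) (single k) ()

  length-injective : pairwise separatedᶠ (families ms) ≡ true → all increasing (families ms) ≡ true →
                     ∀ c c′ → Valid c → Valid c′ → length⟨ c ⟩ ≡ length⟨ c′ ⟩ → c ≡ c′
  length-injective sep inc c c′ v v′ e = place-injective c c′
    (same-place (place c) (place c′) (valid⇒family c v) (valid⇒family c′ v′)
      (trans (sym (length-place c v)) (trans e (length-place c′ v′))))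
    where
    same-place : ∀ p p′ → let m , i , c = p; m′ , i′ , c′ = p′ in
                 familyAt m c ∈ families ms × i < counts m →
                 familyAt m′ c′ ∈ families ms × i′ < counts m′ →
                 ⟦ lengthᶠ (segs m) c ⟧ s i ≡ ⟦ lengthᶠ (segs m′) c′ ⟧ s i′ → p ≡ p′
    same-place (m , i , c) (m′ , i′ , c′) (f∈ , i<) (f∈′ , i<′) e =
      let f≡f′ , i≡i′ = family-values-injective sep inc f∈ f∈′ (1≤l₀ m) (1≤l₀ m′) i< i<′ e
      in cong₂ _,_ (cong index f≡f′) (cong₂ _,_ i≡i′ (cong code f≡f′))

  2*vertices : 2 * vertices ≡ evalq (total ms) s
  2*vertices = total-eval ms s wf

  N-eval : N ≡ evalˡ (segmentCount ms) s
  N-eval = segmentCount-eval ms s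

-- From checked modes to the graph

wellSeparated : List Mode → Bool
wellSeparated ms = pairwise separatedᶠ (families ms) ∧ all increasing (families ms)

-- With r = s + 1, t = a r + b is the linear form lin (a + b) a in s.
construct : ∀ ms a b p q c w →
  all wellFormed ms ∧ all nondegenerate ms ∧ wellSeparated ms ≡ true →
  segmentCount ms ≡ˡ (w ·ˡ lin (a + b) a) ≡ true →
  (quad (16 + c) 0 0 +q 8 ·q total ms) ≤q (p ·q (lin (a + b) a *ˡ lin (a + b) a) +q toQ (q ·ˡ lin (a + b) a)) ≡ true →
  ∀ r → 1 ≤ r → ∀ n → p * ((a * r + b) * (a * r + b)) + q * (a * r + b) ≤ 16 * n + c →
  Σ (Graph n) λ G → (numEdges G ≡ n + w * (a * r + b) ∸ 1) × DistinctCycleLengths G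
construct ms a b p q c w ok countOK sizeOK (suc s) _ n n≥ = go n vertices<n
  where
  wf = proj₁ (∧-true⁻ {all wellFormed ms} ok)
  ok₂ = proj₂ (∧-true⁻ {all wellFormed ms} ok)
  nd = proj₁ (∧-true⁻ {all nondegenerate ms} ok₂)
  ok₃ = proj₂ (∧-true⁻ {all nondegenerate ms} ok₂)
  sep = proj₁ (∧-true⁻ {pairwise separatedᶠ (families ms)} ok₃)
  inc = proj₂ (∧-true⁻ {pairwise separatedᶠ (families ms)} ok₃)
  open Layout ms s wf nd
  t : ℕ
  t = a * suc s + b
  τ : Linear
  τ = lin (a + b) a
  t≡ : evalˡ τ s ≡ t
  t≡ = h a b s
    where h : ∀ a b s → a + b + a * s ≡ a * suc s + b
          h = solve-∀
  vertices<n : vertices < n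
  -- The factor 16 clears the denominators of the bound; `total` is already doubled, hence the 8.
  -- The extra 1 in `suc vertices` is the hub.
  vertices<n = *-cancelˡ-≤ 16 (+-cancelʳ-≤ c (16 * suc vertices) (16 * n) (begin
    16 * suc vertices + c                              ≡⟨ h vertices c ⟩
    (16 + c + 0) + 8 * (2 * vertices)                  ≡⟨ cong (λ x → (16 + c + 0) + 8 * x) 2*vertices ⟩
    (16 + c + 0) + 8 * evalq (total ms) s              ≡⟨ cong₂ _+_ (h′ c) (sym (eval-·q 8 (total ms) s)) ⟩
    evalq (quad (16 + c) 0 0) s + evalq (8 ·q total ms) s
      ≡⟨ sym (eval-+q (quad (16 + c) 0 0) (8 ·q total ms) s) ⟩
    evalq (quad (16 + c) 0 0 +q 8 ·q total ms) s
      ≤⟨ eval-≤q (quad (16 + c) 0 0 +q 8 ·q total ms) (p ·q (τ *ˡ τ) +q toQ (q ·ˡ τ)) s sizeOK ⟩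
    evalq (p ·q (τ *ˡ τ) +q toQ (q ·ˡ τ)) s            ≡⟨ eval-+q (p ·q (τ *ˡ τ)) (toQ (q ·ˡ τ)) s ⟩
    evalq (p ·q (τ *ˡ τ)) s + evalq (toQ (q ·ˡ τ)) s
      ≡⟨ cong₂ _+_ (trans (eval-·q p (τ *ˡ τ) s) (cong (p *_) (trans (eval-*ˡ τ τ s) (cong₂ _*_ t≡ t≡))))
                   (trans (eval-toQ (q ·ˡ τ) s) (trans (eval-·ˡ q τ s) (cong (q *_) t≡))) ⟩
    p * (t * t) + q * t                                ≤⟨ n≥ ⟩
    16 * n + c                                         ∎))
    where
    open ≤-Reasoning
    h : ∀ v c → 16 * suc v + c ≡ (16 + c + 0) + 8 * (2 * v)
    h = solve-∀
    h′ : ∀ c → 16 + c + 0 ≡ 16 + c + 0 + 0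
    h′ = solve-∀
  go : ∀ n → vertices < n → Σ (Graph n) λ G → (numEdges G ≡ n + w * t ∸ 1) × DistinctCycleLengths G
  -- The subtracted 1 is the hub, the only vertex without a parent edge; `suc n + w * t ∸ 1`
  -- computes to `n + w * t`.
  go (suc n) (s≤s v≤n) = graph (suc n)
    , trans (numEdges-graph n (≤-trans base-N v≤n))
        (cong (n +_) (trans N-eval (trans (eval-≡ˡ (segmentCount ms) (w ·ˡ τ) s countOK) (trans (eval-·ˡ w τ s) (cong (w *_) t≡)))))
    , distinct (length-injective sep inc) (suc n)

-- The explicit blocks

infix 8 _·t+_ _·t-_

-- t = 27720 r + 169 with r = s + 1
_·t+_ _·t-_ : ℕ → ℕ → Linear
a ·t+ c = lin (a * 27889 + c) (a * 27720)
a ·t- c = lin (a * 27889 ∸ c) (a * 27720)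

-- Truncated differences; no coefficient is truncated in the uses below.
infixl 6 _-ˡ_ _⊖_

_-ˡ_ : Linear → Linear → Linear
lin a b -ˡ lin c d = lin (a ∸ c) (b ∸ d)

_⊖_ : Form → Form → Form
form a b c ⊖ form a′ b′ c′ = form (a ∸ a′) (b ∸ b′) (c ∸ c′)

progression : Linear → ℕ → Form
progression (lin a b) k = form a b k

singles : Linear → Linear → ℕ → Mode
-- The cycle consists of γ + 1 rim vertices and the hub, hence the 2.
singles n L k = mode n ((progression L k ⊖ constᶠ 2 , constᶠ 0) ∷ [])

interval : Linear → Linear → Mode
interval from to = singles (to -ˡ from) from 1

-- γ is chosen so that consecutive spokes and the rim between them bound the given faces.
fan : Form → List (Form × Form) → List (Form × Form)
fan σ₀ []             = []
fan σ₀ ((f , σ) ∷ fs) = (f ⊖ (σ₀ ⊕ σ ⊕ constᶠ 2) , σ) ∷ fan (σ ⊕ constᶠ 1) fs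

-- All uses have a and c odd, so the halving is exact. Two faces share the σ + 1 edges from the hub
-- to the foot, and the cycle around both is shorter than their sum by 2 (σ + 1) = a t - c + 2. The
-- foot is the `constᶠ 1` that `fan` passes on.
spoke : ℕ → ℕ → Form
spoke a c = form (⌊ a * 27889 ∸ c /2⌋) (a * 13860) 0

-- Indices of blocks start at 0 in every mode; `start` shifts them, so that a later mode continues
-- the same progression.
face : Linear → Linear → ℕ → Form
face L start k = progression (L +ˡ k ·ˡ start) k

-- Merging across a spoke with parameter a loses a t + 1. With the values 11, 13, 13, ..., 21, the
-- cycles around k = 2, 3, 4, ..., 11 consecutive faces among those from 21 t to 31 t lie, up to
-- bounded terms, between 32 t and 42 t, 42 t and 53 t, 53 t and 63 t, ..., 126 t and 137 t. Among
-- these, only families with the same k overlap, and the offsets -57, 7, 210, ... give overlapping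
-- ones different residues modulo k.
commonFaces : Linear → List (Form × Form) → List (Form × Form)
commonFaces i₀ rest =
  (face (21 ·t- 57) i₀ 1 , spoke 11 1) ∷
  (face (22 ·t+ 7) i₀ 1 , spoke 13 1) ∷
  (face (23 ·t+ 210) i₀ 1 , spoke 13 1) ∷
  (face (24 ·t+ 0) i₀ 1 , spoke 15 1) ∷
  (face (25 ·t+ 1) i₀ 1 , spoke 15 1) ∷
  (face (26 ·t+ 0) i₀ 1 , spoke 17 1) ∷
  (face (27 ·t+ 0) i₀ 1 , spoke 17 1) ∷
  (face (28 ·t- 5) i₀ 1 , spoke 19 1) ∷
  (face (29 ·t+ 3) i₀ 1 , spoke 19 1) ∷
  (face (30 ·t+ 3) i₀ 1 , spoke 21 1) ∷ rest

-- Starting the first fans at i = 50 saves enough vertices for the cycles of lengths 32 t + 1 and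
-- 32 t + 2, which bring the number of independent cycles up to 32 t.  startB is (7 t + 1) / 8; the
-- fans from there on carry one more face, of length 19 t + 2 i + 1, which for smaller i would produce
-- lengths that are already taken.
startA startB countB : Linear
startA = lin 50 0
startB = lin 24403 24255
countB = 1 ·t- 741 -ˡ startB

modes : List Mode
modes =
  mode (startB -ˡ startA) (fan (constᶠ 0) (commonFaces startA
    ((face (31 ·t+ 742) startA 1 , constᶠ 0) ∷ []))) ∷
  mode countB (fan (constᶠ 0) (commonFaces startB
    -- The last face grows by 2, so the cycle around all 12 faces grows by 13. This exceeds the
    -- moduli tested, but that family lies above all others.
    ((face (31 ·t+ 742) startB 1 , spoke 1 571) ∷ (face (19 ·t+ 1) startB 2 , constᶠ 0) ∷ []))) ∷
  -- The separate cycles fill the gaps between the ranges of the faces, whose index runs from 50 to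
  -- t - 742, where 31 t + 742 + i reaches 32 t.
  interval (lin 3 0) (19 ·t+ 1 +ˡ 2 ·ˡ startB) ∷
  -- The faces of length 19 t + 2 i + 1 take every other length; these cycles take the ones in
  -- between.
  singles countB (19 ·t+ 2 +ˡ 2 ·ˡ startB) 2 ∷
  interval (21 ·t- 1481) (21 ·t- 7) ∷
  interval (22 ·t- 798) (22 ·t+ 57) ∷
  interval (23 ·t- 734) (23 ·t+ 260) ∷
  interval (24 ·t- 531) (24 ·t+ 50) ∷
  interval (25 ·t- 741) (25 ·t+ 51) ∷
  interval (26 ·t- 740) (26 ·t+ 50) ∷
  interval (27 ·t- 741) (27 ·t+ 50) ∷
  interval (28 ·t- 741) (28 ·t+ 45) ∷
  interval (29 ·t- 746) (29 ·t+ 53) ∷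
  interval (30 ·t- 738) (30 ·t+ 53) ∷
  interval (31 ·t- 738) (31 ·t+ 792) ∷
  interval (32 ·t+ 1) (32 ·t+ 3) ∷ []

mainTheorem1 : ∀ (r : ℕ) → 1 ≤ r →
    ∀ (n : ℕ) →
    6911 * ((27720 * r + 169) * (27720 * r + 169)) + 1028882 * (27720 * r + 169) ≤ 16 * n + 3309665 →
    Σ (Graph n) λ G → (numEdges G ≡ n + 32 * (27720 * r + 169) ∸ 1) × DistinctCycleLengths G
-- Evaluation of closed terms free of r and n: the checks on the modes, the count of 32 t segments,
-- and the bound on the vertices.
mainTheorem1 = construct modes 27720 169 6911 1028882 3309665 32 refl refl refl
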